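{- Let $G$ be a connected block graph with blocks $B_1, B_2,\ldots, B_t$, and let $k\ge 2$ be an integer. Then $$SW_k(G) = \sum_{i=1}^t N_k'(G \setminus B_i).$$
   Context: All graphs are finite, simple, undirected. A block of a graph is a maximal connected induced subgraph without cut vertices; a block graph is a graph in which every block is a complete graph (clique). For a connected graph $G$ and $S\subseteq V(G)$, the Steiner distance $d(S)$ is the minimum number of edges of a connected subgraph of $G$ whose vertex set contains $S$. The Steiner $k$-Wiener index is $SW_k(G)=\sum_{S\subseteq V(G),\,|S|=k} d(S)$. For a block $B_i$, $G\setminus B_i$ denotes the graph obtained from $G$ by deleting all edges of $B_i$ (keeping all vertices). For a graph $H$ with connected components $H_1,\dots,H_p$ (with $n(H_j)=|V(H_j)|$), and a tuple $(l_1,\dots,l_p)$ of nonnegative integers, let $\alpha(l_1,\dots,l_p)$ be the number of nonzero $l_j$ minus $1$. Define $$N_k'(H)=\sum_{\substack{l_1+\cdots+l_p=k\\ 0\le l_1,\dots,l_p<k}} \binom{n(H_1)}{l_1}\cdots\binom{n(H_p)}{l_p}\,\alpha(l_1,\dots,l_p)$$ if $p>1$, and $N_k'(H)=0$ if $H$ is connected. Conventions: $\binom{m}{0}=1$ and $\binom{m}{l}=0$ whenever $m<l$. -}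

module Defs where

open import Data.Bool using (if_then_else_)
open import Data.Bool.Properties using () renaming (_≟_ to _≟ᵇ_)
open import Data.Fin using (Fin; _<?_)
open import Data.Fin.Properties using (all?) renaming (_≟_ to _≟ᶠ_)
open import Data.Fin.Subset using (Subset; inside; outside; _∈_; _⊆_; _-_; ∣_∣; ⊤; Nonempty)
open import Data.Fin.Subset.Properties using (_∈?_; _⊆?_; anySubset?; ⊆-max; ∈⊤)
open import Data.List as List using (List; []; _∷_; allFin; cartesianProduct; cartesianProductWith; deduplicate; filter; length; map; upTo)
import Data.List.Membership.Propositional as List∈
open import Data.List.Membership.Propositional.Properties using (∈-allFin)
open import Data.List.Relation.Unary.Any using (here; there)
open import Data.Nat using (ℕ; zero; suc; _≤_; z≤n; s≤s; _*_; _∸_; _≟_) renaming (_<?_ to _<ℕ?_)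
open import Data.Nat.Combinatorics using (_C_)
open import Data.Nat.ListAction using (sum)
open import Data.Product using (Σ; ∃; ∃₂; _×_; _,_; proj₁; proj₂)
open import Data.Sum using (_⊎_; inj₁; inj₂)
open import Data.Vec as Vec using (Vec; []; _∷_; lookup; tabulate; zipWith)
open import Data.Vec.Properties using (≡-dec; lookup∘tabulate; lookup⇒[]=; []=⇒lookup)
open import Function using (_∘_)
open import Level using (0ℓ)
open import Relation.Binary using (Rel; Decidable; Symmetric)
open import Relation.Binary.Construct.Closure.ReflexiveTransitive as Star using (Star; ε; _◅_; _◅◅_)
open import Relation.Binary.PropositionalEquality using (_≡_; _≢_; refl; sym; trans; subst)
open import Relation.Nullary using (¬_; Dec; yes; no; does; contradiction)
open import Relation.Nullary.Decidable using (map′; _×-dec_; _⊎-dec_; _→-dec_; ¬?; dec-true; ⌊_⌋)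
import Relation.Unary as U

record Graph (n : ℕ) : Set₁ where
  field
    Adj     : Rel (Fin n) 0ℓ
    adj?    : Decidable Adj
    adj-sym : Symmetric Adj
    irrefl  : ∀ {x} → ¬ Adj x x

open Graph public

private
  variable
    n : ℕ

-- `Linked V E`: any two vertices of V are joined by a walk along E.  When E
-- only relates elements of V, this is connectedness of the graph (V , E).
Linked : Subset n → Rel (Fin n) 0ℓ → Set
Linked V E = ∀ x y → x ∈ V → y ∈ V → Star E x y

Connected : Graph n → Set
Connected G = ∀ x y → Star (Adj G) x y

-- Adjacency in the subgraph induced by U.
_[_] : Graph n → Subset n → Rel (Fin n) 0ℓ
(G [ U ]) x y = x ∈ U × y ∈ U × Adj G x y

-- v is a cut vertex of G[U]: deleting v separates two vertices that lie in
-- a common component of G[U].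
IsCutVertex : Graph n → Subset n → Fin n → Set
IsCutVertex G U v = v ∈ U × ∃₂ λ x y →
  x ∈ U - v × y ∈ U - v × Star (G [ U ]) x y × ¬ Star (G [ U - v ]) x y

record IsNonseparable (G : Graph n) (U : Subset n) : Set where
  field
    nonempty    : Nonempty U
    connected   : Linked U (G [ U ])
    noCutVertex : ∀ v → ¬ IsCutVertex G U v

-- A block is represented by its vertex set.
record IsBlock (G : Graph n) (U : Subset n) : Set where
  field
    nonseparable : IsNonseparable G U
    maximal      : ∀ W → IsNonseparable G W → U ⊆ W → W ⊆ U

IsClique : Graph n → Subset n → Set
IsClique G U = ∀ x y → x ∈ U → y ∈ U → x ≢ y → Adj G x y

IsBlockGraph : Graph n → Set
IsBlockGraph G = ∀ U → IsBlock G U → IsClique G U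

record AreTheBlocks (G : Graph n) {t : ℕ} (B : Fin t → Subset n) : Set where
  field
    isBlock  : ∀ i → IsBlock G (B i)
    distinct : ∀ {i j} → B i ≡ B j → i ≡ j
    complete : ∀ U → IsBlock G U → ∃ λ i → B i ≡ U

-- Blocks are induced, so the edges of the block on U are those with both ends
-- in U.
_∖_ : Graph n → Subset n → Graph n
G ∖ U = record
  { Adj     = λ x y → Adj G x y × ¬ (x ∈ U × y ∈ U)
  ; adj?    = λ x y → adj? G x y ×-dec ¬? (x ∈? U ×-dec y ∈? U)
  ; adj-sym = λ (a , ¬b) → adj-sym G a , λ (p , q) → ¬b (q , p)
  ; irrefl  = λ (a , _) → irrefl G a
  }

module _ {R : Rel (Fin n) 0ℓ} (R? : Decidable R) where

  private
    -- Walks whose interior vertices come from the list (Warshall).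
    Via : List (Fin n) → Rel (Fin n) 0ℓ
    Via []       x y = x ≡ y ⊎ R x y
    Via (v ∷ vs) x y = Via vs x y ⊎ (Via vs x v × Via vs v y)

    via? : ∀ vs → Decidable (Via vs)
    via? []       x y = (x ≟ᶠ y) ⊎-dec R? x y
    via? (v ∷ vs) x y = via? vs x y ⊎-dec (via? vs x v ×-dec via? vs v y)

    via⇒star : ∀ vs {x y} → Via vs x y → Star R x y
    via⇒star []       (inj₁ refl)    = ε
    via⇒star []       (inj₂ r)       = r ◅ ε
    via⇒star (v ∷ vs) (inj₁ p)       = via⇒star vs p
    via⇒star (v ∷ vs) (inj₂ (p , q)) = via⇒star vs p ◅◅ via⇒star vs q

    base : ∀ vs {x y} → x ≡ y ⊎ R x y → Via vs x y
    base []       p = p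
    base (v ∷ vs) p = inj₁ (base vs p)

    via-trans : ∀ {vs v x y} → v List∈.∈ vs → Via vs x v → Via vs v y → Via vs x y
    via-trans (here refl) (inj₁ p)       (inj₁ q)       = inj₂ (p , q)
    via-trans (here refl) (inj₁ p)       (inj₂ (_ , q)) = inj₂ (p , q)
    via-trans (here refl) (inj₂ (p , _)) (inj₁ q)       = inj₂ (p , q)
    via-trans (here refl) (inj₂ (p , _)) (inj₂ (_ , q)) = inj₂ (p , q)
    via-trans (there v∈)  (inj₁ p)       (inj₁ q)       = inj₁ (via-trans v∈ p q)
    via-trans (there v∈)  (inj₁ p)       (inj₂ (q , r)) = inj₂ (via-trans v∈ p q , r)
    via-trans (there v∈)  (inj₂ (p , q)) (inj₁ r)       = inj₂ (p , via-trans v∈ q r)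
    via-trans (there v∈)  (inj₂ (p , _)) (inj₂ (_ , q)) = inj₂ (p , q)

    star⇒via : ∀ {x y} → Star R x y → Via (allFin n) x y
    star⇒via ε       = base (allFin n) (inj₁ refl)
    star⇒via (r ◅ s) = via-trans (∈-allFin _) (base (allFin n) (inj₂ r)) (star⇒via s)

  star? : Decidable (Star R)
  star? x y = map′ (via⇒star (allFin n)) star⇒via (via? (allFin n) x y)

toSubset : {P : U.Pred (Fin n) 0ℓ} → U.Decidable P → Subset n
toSubset P? = tabulate (λ x → does (P? x))

∈-toSubset⁺ : {P : U.Pred (Fin n) 0ℓ} (P? : U.Decidable P) → ∀ {x} → P x → x ∈ toSubset P?
∈-toSubset⁺ P? {x} p =
  lookup⇒[]= x _ (trans (lookup∘tabulate _ x) (dec-true (P? x) p))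

∈-toSubset⁻ : {P : U.Pred (Fin n) 0ℓ} (P? : U.Decidable P) → ∀ {x} → x ∈ toSubset P? → P x
∈-toSubset⁻ P? {x} x∈ with P? x | trans (sym (lookup∘tabulate (λ y → does (P? y)) x)) ([]=⇒lookup x∈)
... | yes p | _  = p
... | no _  | ()

tuples : {A : Set} → List A → (p : ℕ) → List (Vec A p)
tuples xs zero    = [] ∷ []
tuples xs (suc p) = cartesianProductWith _∷_ xs (tuples xs p)

subsetsOfSize : (n k : ℕ) → List (Subset n)
subsetsOfSize n k = filter (λ S → ∣ S ∣ ≟ k) (tuples (inside ∷ outside ∷ []) n)

-- Edge sets are stored as adjacency matrices, so that they can be searched.
EdgeSet : ℕ → Set
EdgeSet n = Vec (Subset n) n

Edge : EdgeSet n → Rel (Fin n) 0ℓ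
Edge E x y = y ∈ lookup E x

edge? : (E : EdgeSet n) → Decidable (Edge E)
edge? E x y = y ∈? lookup E x

edgeCount : EdgeSet n → ℕ
edgeCount {n} E =
  length (filter (λ (x , y) → (x <? y) ×-dec edge? E x y)
                 (cartesianProduct (allFin n) (allFin n)))

IsSubgraph : Graph n → Subset n → EdgeSet n → Set
IsSubgraph G V E = ∀ x y → Edge E x y → Adj G x y × Edge E y x × x ∈ V × y ∈ V

Connects : Graph n → Subset n → ℕ → Set
Connects {n} G S m = Σ (Subset n) λ V → Σ (EdgeSet n) λ E →
  IsSubgraph G V E × Linked V (Edge E) × S ⊆ V × edgeCount E ≡ m

IsSteinerDistance : Graph n → Subset n → ℕ → Set
IsSteinerDistance G S d = Connects G S d × (∀ m → Connects G S m → d ≤ m)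

private
  anyMatrix? : ∀ {m} {P : U.Pred (Vec (Subset n) m) 0ℓ} → U.Decidable P → Dec (∃ P)
  anyMatrix? {m = zero}  P? = map′ (λ p → [] , p) (λ { ([] , p) → p }) (P? [])
  anyMatrix? {m = suc m} P? =
    map′ (λ (S , E , p) → S ∷ E , p) (λ { (S ∷ E , p) → S , E , p })
         (anySubset? λ S → anyMatrix? λ E → P? (S ∷ E))

  isSubgraph? : (G : Graph n) → ∀ V E → Dec (IsSubgraph G V E)
  isSubgraph? G V E = all? λ x → all? λ y → edge? E x y →-dec
    (adj? G x y ×-dec edge? E y x ×-dec x ∈? V ×-dec y ∈? V)

  linked? : ∀ V {E : Rel (Fin n) 0ℓ} → Decidable E → Dec (Linked V E)
  linked? V E? = all? λ x → all? λ y → x ∈? V →-dec y ∈? V →-dec star? E? x y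

  connects? : (G : Graph n) → ∀ S → U.Decidable (Connects G S)
  connects? G S m = anySubset? λ V → anyMatrix? λ E →
    isSubgraph? G V E ×-dec linked? V (edge? E) ×-dec S ⊆? V ×-dec edgeCount E ≟ m

  least : {P : U.Pred ℕ 0ℓ} → U.Decidable P → ∀ m → P m →
          ∃ λ d → P d × (∀ e → P e → d ≤ e)
  least P? m pm with P? 0
  least P? m       pm | yes p0 = 0 , p0 , λ _ _ → z≤n
  least P? zero    pm | no ¬p0 = contradiction pm ¬p0
  least P? (suc m) pm | no ¬p0 with least (P? ∘ suc) m pm
  ... | d , pd , min = suc d , pd ,
    λ { zero p0 → contradiction p0 ¬p0 ; (suc e) pe → s≤s (min e pe) }

  adjacencyMatrix : Graph n → EdgeSet n
  adjacencyMatrix G = tabulate λ x → toSubset (adj? G x)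

  adj⇒edge : (G : Graph n) → ∀ {x y} → Adj G x y → Edge (adjacencyMatrix G) x y
  adj⇒edge G {x} {y} a =
    subst (y ∈_) (sym (lookup∘tabulate _ x)) (∈-toSubset⁺ (adj? G x) a)

  edge⇒adj : (G : Graph n) → ∀ {x y} → Edge (adjacencyMatrix G) x y → Adj G x y
  edge⇒adj G {x} {y} e =
    ∈-toSubset⁻ (adj? G x) (subst (y ∈_) (lookup∘tabulate _ x) e)

-- In a connected graph G itself is a candidate, so the minimum exists.
steiner : (G : Graph n) → Connected G → ∀ S → ∃ (IsSteinerDistance G S)
steiner G conn S = least (connects? G S) (edgeCount M)
  ( ⊤ , M
  , (λ x y e → edge⇒adj G e , adj⇒edge G (adj-sym G (edge⇒adj G e)) , ∈⊤ , ∈⊤)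
  , (λ x y _ _ → Star.map (adj⇒edge G) (conn x y))
  , ⊆-max S , refl )
  where M = adjacencyMatrix G

steinerDistance : (G : Graph n) → Connected G → Subset n → ℕ
steinerDistance G conn S = proj₁ (steiner G conn S)

SW : ℕ → (G : Graph n) → Connected G → ℕ
SW {n} k G conn = sum (map (steinerDistance G conn) (subsetsOfSize n k))

component : Graph n → Fin n → Subset n
component H v = toSubset (star? (adj? H) v)

components : Graph n → List (Subset n)
components {n} H = deduplicate (≡-dec _≟ᵇ_) (map (component H) (allFin n))

-- The number of nonzero entries minus 1; N′ only uses it on tuples with
-- positive sum, where the subtraction does not truncate.
α : ∀ {p} → Vec ℕ p → ℕ
α l = Vec.count (λ lⱼ → ¬? (lⱼ ≟ 0)) l ∸ 1

-- `upTo k` is 0, …, k - 1, and m C l is 0 for m < l.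
N′-sizes : ℕ → ∀ {p} → Vec ℕ p → ℕ
N′-sizes k {p} sizes =
  sum (map (λ l → Vec.foldr _ _*_ 1 (zipWith _C_ sizes l) * α l)
           (filter (λ l → Vec.sum l ≟ k) (tuples (upTo k) p)))

N′ : ℕ → Graph n → ℕ
N′ k H = if ⌊ 1 <ℕ? length (components H) ⌋
         then N′-sizes k (Vec.map ∣_∣ (Vec.fromList (components H)))
         else 0

module Submission where

open import Defs
import Algebra.Properties.CommutativeSemigroup as CommutativeSemigroup
open import Data.Bool using (Bool; true; false; if_then_else_)
open import Data.Bool.Properties using () renaming (_≟_ to _≟ᵇ_)
open import Data.Empty using (⊥-elim)
open import Data.Fin using (Fin; zero; suc; _<_; _<?_)
open import Data.Fin.Properties using (all?; any?; <-cmp; <-irrefl; <-asym) renaming (_≟_ to _≟ᶠ_)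
open import Data.Fin.Subset using (Subset; inside; outside; _∈_; _∉_; _⊆_; _∩_; _∪_; _─_; _-_; ⁅_⁆; ∣_∣; Nonempty)
open import Data.Fin.Subset.Properties using (_∈?_; _⊆?_; anySubset?; nonempty?; Empty-unique; ∣⊥∣≡0; ∣p∣≤n; p⊂q⇒∣p∣<∣q∣; p─q⊆p; x∈p∧x≢y⇒x∈p-y; x∈p⇒∣p-x∣<∣p∣; x∈⁅x⁆; x∈⁅y⁆⇒x≡y; x∈p∪q⁻; x∈p∪q⁺; x∈p∩q⁺; x∈p∩q⁻; ⊆-antisym)
open import Data.List as List using (List; []; _∷_; _++_; allFin; cartesianProduct; cartesianProductWith; concatMap; filter; length; map; tabulate; upTo)
import Data.List.Membership.DecPropositional as List∈?
import Data.List.Membership.Propositional as List∈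
open import Data.List.Membership.Propositional.Properties using (∈-allFin; ∈-cartesianProduct⁺; ∈-concatMap⁺; ∈-concatMap⁻; ∈-deduplicate⁺; ∈-deduplicate⁻; ∈-filter⁺; ∈-filter⁻; ∈-map⁺; ∈-map⁻; ∈-∃++; ∈-++⁻; ∈-++⁺ˡ; ∈-++⁺ʳ)
open import Data.List.Properties using (filter-all; length-++; length-++-sucʳ; length-filter; length-map; map-++; map-applyUpTo; map-tabulate; map-upTo; map-∘)
open import Data.List.Relation.Unary.All as All using (All; []; _∷_)
import Data.List.Relation.Unary.All.Properties as All
open import Data.List.Relation.Unary.AllPairs using (AllPairs; []; _∷_)
import Data.List.Relation.Unary.AllPairs.Properties as AllPairs
open import Data.List.Relation.Unary.Any as Any using (here; there)
open import Data.List.Relation.Unary.Unique.DecPropositional.Properties using (deduplicate-!)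
open import Data.List.Relation.Unary.Unique.Propositional using (Unique)
import Data.List.Relation.Unary.Unique.Propositional.Properties as Unique
open import Data.Nat using (ℕ; zero; suc; _≤_; z≤n; s≤s; s≤s⁻¹; _+_; _*_; _∸_; _≟_) renaming (_<?_ to _<ℕ?_)
open import Data.Nat.Combinatorics using (nCk+nC[k+1]≡[n+1]C[k+1]) renaming (_C_ to _choose_)
open import Data.Nat.ListAction using (sum)
open import Data.Nat.ListAction.Properties using (sum-++)
open import Data.Nat.Properties using (≤-refl; ≤-reflexive; ≤-trans; ≤-antisym; <-≤-trans; ≮⇒≥; +-assoc; +-comm; +-suc; +-identityʳ; +-cancelˡ-≤; +-mono-≤; +-commutativeSemigroup; *-assoc; *-zeroʳ; *-distribˡ-+; *-distribʳ-+; ∸-monoˡ-≤; ∸-monoʳ-<; m≤m+n; m≤n+m; m≤n⇒m≤1+n; m≤n⇒m∸n≡0; m∸n≡0⇒m≤n; n≤0⇒n≡0; module ≤-Reasoning) renaming (<-irrefl to <ⁿ-irrefl)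
open import Data.Product using (_×_; _,_; proj₁; proj₂; ∃)
import Data.Product.Properties as Product
open import Data.Sum using (_⊎_; inj₁; inj₂; swap)
open import Data.Vec as Vec using (Vec; []; _∷_; here; there; lookup)
open import Data.Vec.Properties using (≡-dec; []=⇒lookup; lookup⇒[]=; lookup∘tabulate)
open import Data.Vec.Relation.Unary.Any using (Any; here; there)
open import Function using (_∘_; id)
open import Level using (0ℓ)
open import Relation.Binary using (Rel; Decidable; DecidableEquality; tri<; tri≈; tri>)
open import Relation.Binary.Construct.Closure.ReflexiveTransitive as Star using (Star; ε; _◅_; _◅◅_)
open import Relation.Binary.PropositionalEquality using (_≡_; _≢_; refl; sym; trans; cong; cong₂; subst; module ≡-Reasoning)
open import Relation.Nullary using (¬_; Dec; yes; no; does; contradiction)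
open import Relation.Nullary.Decidable using (map′; _×-dec_; _⊎-dec_; _→-dec_; ¬?)
import Relation.Unary as U

-- For a nonempty S, the Steiner distance of S is the sum over the blocks B of
-- c(B) − 1, where c(B) is the number of components of G ∖ B that meet S.
-- Every connected subgraph containing S uses at least c(B) − 1 edges of B, as
-- these edges have to join the c(B) components, and an edge lies in only one
-- block.  Conversely, each of these components has exactly one vertex in B: a
-- second one would give a path outside B between two vertices of B, and adding
-- it to B contradicts maximality.  Since B is a clique, c(B) − 1 edges join these
-- vertices by a star, and a walk between two vertices of S that visits no block
-- twice shows that the stars together connect S.  Summing over S, the term of B is N′ k (G ∖ B): the sets S
-- are sorted by the numbers of vertices that they have in each component.

private
  variable
    A A′ A″ : Set
    m n p t : ℕ

-- Finite sums over lists.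

+-medial : ∀ a b c d → (a + b) + (c + d) ≡ (a + c) + (b + d)
+-medial = CommutativeSemigroup.interchange +-commutativeSemigroup

∑ : List A → (A → ℕ) → ℕ
∑ xs f = sum (map f xs)

syntax ∑ xs (λ x → e) = ∑[ x ← xs ] e

∑-cong : (xs : List A) {f g : A → ℕ} → (∀ x → x List∈.∈ xs → f x ≡ g x) → ∑ xs f ≡ ∑ xs g
∑-cong []       eq = refl
∑-cong (x ∷ xs) eq = cong₂ _+_ (eq x (here refl)) (∑-cong xs (λ y y∈ → eq y (there y∈)))

∑-mono : (xs : List A) {f g : A → ℕ} → (∀ x → x List∈.∈ xs → f x ≤ g x) → ∑ xs f ≤ ∑ xs g
∑-mono []       le = z≤n
∑-mono (x ∷ xs) le = +-mono-≤ (le x (here refl)) (∑-mono xs (λ y y∈ → le y (there y∈)))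

∑-zero : (xs : List A) {f : A → ℕ} → (∀ x → f x ≡ 0) → ∑ xs f ≡ 0
∑-zero []       eq = refl
∑-zero (x ∷ xs) eq = cong₂ _+_ (eq x) (∑-zero xs eq)

∑-+ : (xs : List A) (f g : A → ℕ) → ∑[ x ← xs ] (f x + g x) ≡ ∑ xs f + ∑ xs g
∑-+ []       f g = refl
∑-+ (x ∷ xs) f g = begin
  (f x + g x) + ∑ xs (λ y → f y + g y) ≡⟨ cong ((f x + g x) +_) (∑-+ xs f g) ⟩
  (f x + g x) + (∑ xs f + ∑ xs g)      ≡⟨ +-medial (f x) (g x) (∑ xs f) (∑ xs g) ⟩
  (f x + ∑ xs f) + (g x + ∑ xs g)      ∎
  where open ≡-Reasoning

∑-*ˡ : (xs : List A) (c : ℕ) (f : A → ℕ) → ∑[ x ← xs ] (c * f x) ≡ c * ∑ xs f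
∑-*ˡ []       c f = sym (*-zeroʳ c)
∑-*ˡ (x ∷ xs) c f = trans (cong (c * f x +_) (∑-*ˡ xs c f)) (sym (*-distribˡ-+ c (f x) (∑ xs f)))

∑-swap : (xs : List A) (ys : List A′) (f : A → A′ → ℕ) →
         ∑[ x ← xs ] ∑[ y ← ys ] f x y ≡ ∑[ y ← ys ] ∑[ x ← xs ] f x y
∑-swap []       ys f = sym (∑-zero ys (λ _ → refl))
∑-swap (x ∷ xs) ys f = trans (cong (∑ ys (f x) +_) (∑-swap xs ys f))
                             (sym (∑-+ ys (f x) (λ y → ∑[ z ← xs ] f z y)))

∑-map : (g : A → A′) (xs : List A) (f : A′ → ℕ) → ∑ (map g xs) f ≡ ∑ xs (f ∘ g)
∑-map g xs f = cong sum (sym (map-∘ xs))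

∑-++ : (xs ys : List A) (f : A → ℕ) → ∑ (xs ++ ys) f ≡ ∑ xs f + ∑ ys f
∑-++ xs ys f = trans (cong sum (map-++ f xs ys)) (sum-++ (map f xs) (map f ys))

∑-cartesianProductWith : (g : A → A′ → A″) (xs : List A) (ys : List A′) (f : A″ → ℕ) →
  ∑ (cartesianProductWith g xs ys) f ≡ ∑[ x ← xs ] ∑[ y ← ys ] f (g x y)
∑-cartesianProductWith g []       ys f = refl
∑-cartesianProductWith g (x ∷ xs) ys f =
  trans (∑-++ (map (g x) ys) (cartesianProductWith g xs ys) f)
        (cong₂ _+_ (∑-map (g x) ys f) (∑-cartesianProductWith g xs ys f))

∑-filter : {P : U.Pred A 0ℓ} (P? : U.Decidable P) (xs : List A) (f : A → ℕ) →
           ∑ (filter P? xs) f ≡ ∑[ x ← xs ] (if does (P? x) then f x else 0)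
∑-filter P? []       f = refl
∑-filter P? (x ∷ xs) f with P? x
... | yes _ = cong (f x +_) (∑-filter P? xs f)
... | no  _ = ∑-filter P? xs f

length-filter≡∑ : {P : U.Pred A 0ℓ} (P? : U.Decidable P) (xs : List A) →
                  length (filter P? xs) ≡ ∑[ x ← xs ] (if does (P? x) then 1 else 0)
length-filter≡∑ P? []       = refl
length-filter≡∑ P? (x ∷ xs) with P? x
... | yes _ = cong suc (length-filter≡∑ P? xs)
... | no  _ = length-filter≡∑ P? xs

sum-tabulate : ∀ {t} (f : Fin t → ℕ) → sum (tabulate f) ≡ ∑ (allFin t) f
sum-tabulate f = cong sum (sym (map-tabulate id f))

-- Sums weighted by binomial coefficients.

-- `binom m f` is ∑ₗ C(m, l) f(l), presented by Pascal's rule so that it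
-- needs no bound on l.
binom : ℕ → (ℕ → ℕ) → ℕ
binom zero    f = f 0
binom (suc m) f = binom m f + binom m (f ∘ suc)

binom-cong : ∀ m {f g} → (∀ l → f l ≡ g l) → binom m f ≡ binom m g
binom-cong zero    eq = eq 0
binom-cong (suc m) eq = cong₂ _+_ (binom-cong m eq) (binom-cong m (eq ∘ suc))

binom-+ : ∀ m f g → binom m (λ l → f l + g l) ≡ binom m f + binom m g
binom-+ zero    f g = refl
binom-+ (suc m) f g = trans
  (cong₂ _+_ (binom-+ m f g) (binom-+ m (f ∘ suc) (g ∘ suc)))
  (+-medial (binom m f) (binom m g) (binom m (f ∘ suc)) (binom m (g ∘ suc)))

binom-zero : ∀ m {f} → (∀ l → f l ≡ 0) → binom m f ≡ 0
binom-zero zero    eq = eq 0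
binom-zero (suc m) eq = cong₂ _+_ (binom-zero m eq) (binom-zero m (eq ∘ suc))

∑-upTo-suc : ∀ k (f : ℕ → ℕ) → ∑ (upTo (suc k)) f ≡ f 0 + ∑ (upTo k) (f ∘ suc)
∑-upTo-suc k f = cong (λ l → f 0 + sum l)
  (trans (map-applyUpTo suc f k) (sym (map-upTo (f ∘ suc) k)))

-- Induction on both `m` and `k`: Pascal's rule recombines the two halves, and shifting the argument
-- of `f` lowers the vanishing bound by one. Terms from that bound on are zero, so summing over
-- `upTo k` loses nothing.
binom-expand : ∀ m k f → (∀ l → k ≤ l → f l ≡ 0) →
               binom m f ≡ ∑[ l ← upTo k ] ((m choose l) * f l)
binom-expand m       zero    f f≡0 = binom-zero m (λ l → f≡0 l z≤n)
binom-expand zero    (suc k) f f≡0 = begin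
  f 0                                                    ≡⟨ +-identityʳ (f 0) ⟨
  f 0 + 0                                                ≡⟨ cong₂ _+_ (+-identityʳ (f 0))
                                                            (∑-zero (upTo k) (λ _ → refl)) ⟨
  1 * f 0 + ∑[ l ← upTo k ] ((0 choose suc l) * f (suc l))    ≡⟨ ∑-upTo-suc k (λ l → (0 choose l) * f l) ⟨
  ∑[ l ← upTo (suc k) ] ((0 choose l) * f l)                  ∎
  where open ≡-Reasoning
binom-expand (suc m) (suc k) f f≡0 = begin
  binom m f + binom m (f ∘ suc)
    ≡⟨ cong₂ _+_ (binom-expand m (suc k) f f≡0)
                 (binom-expand m k (f ∘ suc) (λ l k≤l → f≡0 (suc l) (s≤s k≤l))) ⟩
  ∑[ l ← upTo (suc k) ] ((m choose l) * f l) + ∑ (upTo k) g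
    ≡⟨ cong (_+ ∑ (upTo k) g) (∑-upTo-suc k (λ l → (m choose l) * f l)) ⟩
  ((m choose 0) * f 0 + ∑ (upTo k) h) + ∑ (upTo k) g
    ≡⟨ +-assoc ((m choose 0) * f 0) (∑ (upTo k) h) (∑ (upTo k) g) ⟩
  (m choose 0) * f 0 + (∑ (upTo k) h + ∑ (upTo k) g)
    ≡⟨ cong₂ (λ a b → a * f 0 + b) (trans (C0 m) (sym (C0 (suc m)))) (sym (∑-+ (upTo k) h g)) ⟩
  (suc m choose 0) * f 0 + ∑[ l ← upTo k ] (h l + g l)
    ≡⟨ cong ((suc m choose 0) * f 0 +_) (∑-cong (upTo k) (λ l _ → pascal l)) ⟩
  (suc m choose 0) * f 0 + ∑[ l ← upTo k ] ((suc m choose suc l) * f (suc l))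
    ≡⟨ ∑-upTo-suc k (λ l → (suc m choose l) * f l) ⟨
  ∑[ l ← upTo (suc k) ] ((suc m choose l) * f l) ∎
  where
  open ≡-Reasoning
  g h : ℕ → ℕ
  g l = (m choose l) * f (suc l)
  h l = (m choose suc l) * f (suc l)
  C0 : ∀ a → a choose 0 ≡ 1
  C0 zero    = refl
  C0 (suc a) = refl
  pascal : ∀ l → h l + g l ≡ (suc m choose suc l) * f (suc l)
  pascal l = begin
    h l + g l                                ≡⟨ *-distribʳ-+ (f (suc l)) (m choose suc l) (m choose l) ⟨
    ((m choose suc l) + (m choose l)) * f (suc l)      ≡⟨ cong (_* f (suc l)) (+-comm (m choose suc l) (m choose l)) ⟩
    ((m choose l) + (m choose suc l)) * f (suc l)      ≡⟨ cong (_* f (suc l)) (nCk+nC[k+1]≡[n+1]C[k+1] m l) ⟩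
    (suc m choose suc l) * f (suc l)              ∎

binoms : Vec ℕ p → (Vec ℕ p → ℕ) → ℕ
binoms []       φ = φ []
binoms (m ∷ ms) φ = binom m (λ l → binoms ms (φ ∘ (l ∷_)))

-- Coordinatewise iteration of `binom-expand`. Tuples with an entry of at least `k` are missing on
-- the right, hence the vanishing hypothesis on `φ`.
binoms-expand : ∀ k (ms : Vec ℕ p) φ → (∀ l → Any (k ≤_) l → φ l ≡ 0) →
  binoms ms φ ≡ ∑[ l ← tuples (upTo k) p ] (Vec.foldr _ _*_ 1 (Vec.zipWith _choose_ ms l) * φ l)
binoms-expand k []       φ φ≡0 = sym (trans (+-identityʳ _) (+-identityʳ _))
binoms-expand {suc p} k (m ∷ ms) φ φ≡0 = begin
  binom m (λ l → binoms ms (φ ∘ (l ∷_)))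
    ≡⟨ binom-expand m k _ (λ l k≤l → trans
         (binoms-expand k ms _ (λ ls _ → φ≡0 (l ∷ ls) (here k≤l)))
         (∑-zero ts (λ ls →
           trans (cong (weight ls *_) (φ≡0 (l ∷ ls) (here k≤l))) (*-zeroʳ (weight ls))))) ⟩
  ∑[ l ← upTo k ] ((m choose l) * binoms ms (φ ∘ (l ∷_)))
    ≡⟨ ∑-cong (upTo k) (λ l _ → begin
         (m choose l) * binoms ms (φ ∘ (l ∷_))
           ≡⟨ cong ((m choose l) *_) (binoms-expand k ms _ (λ ls any → φ≡0 (l ∷ ls) (there any))) ⟩
         (m choose l) * ∑[ ls ← ts ] (weight ls * φ (l ∷ ls))
           ≡⟨ ∑-*ˡ ts (m choose l) (λ ls → weight ls * φ (l ∷ ls)) ⟨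
         ∑[ ls ← ts ] ((m choose l) * (weight ls * φ (l ∷ ls)))
           ≡⟨ ∑-cong ts (λ ls _ → sym (*-assoc (m choose l) (weight ls) (φ (l ∷ ls)))) ⟩
         ∑[ ls ← ts ] (((m choose l) * weight ls) * φ (l ∷ ls)) ∎) ⟩
  ∑[ l ← upTo k ] ∑[ ls ← ts ] (((m choose l) * weight ls) * φ (l ∷ ls))
    ≡⟨ ∑-cartesianProductWith _∷_ (upTo k) ts (λ l → Vec.foldr _ _*_ 1 (Vec.zipWith _choose_ (m ∷ ms) l) * φ l) ⟨
  ∑[ l ← tuples (upTo k) (suc p) ] (Vec.foldr _ _*_ 1 (Vec.zipWith _choose_ (m ∷ ms) l) * φ l) ∎
  where
  open ≡-Reasoning
  ts = tuples (upTo k) p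
  weight : Vec ℕ p → ℕ
  weight = λ ls → Vec.foldr (λ _ → ℕ) _*_ 1 (Vec.zipWith _choose_ ms ls)

-- Counting the subsets of a partitioned ground set by their profiles.

data OneHot : Vec Bool p → Set where
  here  : OneHot (true ∷ Vec.replicate p false)
  there : {h : Vec Bool p} → OneHot h → OneHot (false ∷ h)

-- Entrywise addition of a 0-1 vector. When a vertex joins the ground set and `h` marks its part,
-- the part sizes change by `bump h`, as does the profile of a set that contains the vertex.
bump : Vec Bool p → Vec ℕ p → Vec ℕ p
bump []          []       = []
bump (true  ∷ h) (l ∷ ls) = suc l ∷ bump h ls
bump (false ∷ h) (l ∷ ls) = l ∷ bump h ls

bump-none : (ls : Vec ℕ p) → bump (Vec.replicate p false) ls ≡ ls
bump-none []       = refl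
bump-none (l ∷ ls) = cong (l ∷_) (bump-none ls)

sum-bump : {h : Vec Bool p} → OneHot h → ∀ ls → Vec.sum (bump h ls) ≡ suc (Vec.sum ls)
sum-bump here      (l ∷ ls) = cong (λ ls → suc (l + Vec.sum ls)) (bump-none ls)
sum-bump (there o) (l ∷ ls) = trans (cong (l +_) (sum-bump o ls)) (+-suc l (Vec.sum ls))

binoms-cong : (ms : Vec ℕ p) {φ ψ : Vec ℕ p → ℕ} → (∀ l → φ l ≡ ψ l) → binoms ms φ ≡ binoms ms ψ
binoms-cong []       eq = eq []
binoms-cong (m ∷ ms) eq = binom-cong m (λ l → binoms-cong ms (λ ls → eq (l ∷ ls)))

-- Pascal's rule in the coordinate marked by `h`: the added element of that part is either chosen,
-- which bumps the tuple, or left out.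
binoms-bump : {h : Vec Bool p} → OneHot h → ∀ ms φ →
              binoms (bump h ms) φ ≡ binoms ms (φ ∘ bump h) + binoms ms φ
binoms-bump (here {p}) (m ∷ ms) φ rewrite bump-none ms = trans
  (+-comm (binom m (λ l → binoms ms (φ ∘ (l ∷_)))) _)
  (cong (_+ binom m (λ l → binoms ms (φ ∘ (l ∷_))))
        (binom-cong m (λ l → binoms-cong ms (λ ls →
          cong (λ ls → φ (suc l ∷ ls)) (sym (bump-none ls))))))
binoms-bump (there {h = h} o) (m ∷ ms) φ = trans
  (binom-cong m (λ l → binoms-bump o ms (φ ∘ (l ∷_))))
  (binom-+ m (λ l → binoms ms (φ ∘ (l ∷_) ∘ bump h)) (λ l → binoms ms (φ ∘ (l ∷_))))

membership : Fin n → Vec (Subset n) p → Vec Bool p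
membership x = Vec.map (λ C → lookup C x)

Partition : Vec (Subset n) p → Set
Partition Cs = ∀ x → OneHot (membership x Cs)

profile : Subset n → Vec (Subset n) p → Vec ℕ p
profile S = Vec.map (λ C → ∣ S ∩ C ∣)

tails : Vec (Subset (suc n)) p → Vec (Subset n) p
tails = Vec.map Vec.tail

profile-outside : (S : Subset n) (Cs : Vec (Subset (suc n)) p) →
                  profile (outside ∷ S) Cs ≡ profile S (tails Cs)
profile-outside S []             = refl
profile-outside S ((c ∷ C) ∷ Cs) = cong (∣ S ∩ C ∣ ∷_) (profile-outside S Cs)

profile-inside : (S : Subset n) (Cs : Vec (Subset (suc n)) p) →
                 profile (inside ∷ S) Cs ≡ bump (membership zero Cs) (profile S (tails Cs))
profile-inside S []                 = refl
profile-inside S ((true  ∷ C) ∷ Cs) = cong (suc ∣ S ∩ C ∣ ∷_) (profile-inside S Cs)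
profile-inside S ((false ∷ C) ∷ Cs) = cong (∣ S ∩ C ∣ ∷_) (profile-inside S Cs)

sizes-bump : (Cs : Vec (Subset (suc n)) p) →
             Vec.map ∣_∣ Cs ≡ bump (membership zero Cs) (Vec.map ∣_∣ (tails Cs))
sizes-bump []                 = refl
sizes-bump ((true  ∷ C) ∷ Cs) = cong (suc ∣ C ∣ ∷_) (sizes-bump Cs)
sizes-bump ((false ∷ C) ∷ Cs) = cong (∣ C ∣ ∷_) (sizes-bump Cs)

membership-tails : (x : Fin n) (Cs : Vec (Subset (suc n)) p) →
                   membership (suc x) Cs ≡ membership x (tails Cs)
membership-tails x []             = refl
membership-tails x ((c ∷ C) ∷ Cs) = cong (lookup C x ∷_) (membership-tails x Cs)

tails-partition : {Cs : Vec (Subset (suc n)) p} → Partition Cs → Partition (tails Cs)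
tails-partition {Cs = Cs} part x = subst OneHot (membership-tails x Cs) (part (suc x))

-- A product of binomial coefficients counts the sets with a given profile. Induction on the ground
-- set: splitting by whether vertex `zero` lies in `S` mirrors the two terms of `binoms-bump`.
∑-profiles : ∀ n {Cs : Vec (Subset n) p} → Partition Cs → (φ : Vec ℕ p → ℕ) →
  ∑[ S ← tuples (inside ∷ outside ∷ []) n ] φ (profile S Cs) ≡ binoms (Vec.map ∣_∣ Cs) φ
∑-profiles zero {Cs} part φ = trans (+-identityʳ _) (empty Cs φ)
  where
  empty : ∀ {p} (Cs : Vec (Subset 0) p) φ → φ (profile [] Cs) ≡ binoms (Vec.map ∣_∣ Cs) φ
  empty []        φ = refl
  empty ([] ∷ Cs) φ = empty Cs (φ ∘ (0 ∷_))
∑-profiles (suc n) {Cs} part φ = begin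
  ∑ (tuples sides (suc n)) (λ S → φ (profile S Cs))
    ≡⟨ ∑-cartesianProductWith _∷_ sides (tuples sides n) _ ⟩
  ∑[ S ← tuples sides n ] φ (profile (inside ∷ S) Cs)
    + (∑[ S ← tuples sides n ] φ (profile (outside ∷ S) Cs) + 0)
    ≡⟨ cong₂ _+_ (∑-cong (tuples sides n) (λ S _ → cong φ (profile-inside S Cs)))
         (trans (+-identityʳ _)
           (∑-cong (tuples sides n) (λ S _ → cong φ (profile-outside S Cs)))) ⟩
  ∑[ S ← tuples sides n ] φ (bump h (profile S (tails Cs)))
    + ∑[ S ← tuples sides n ] φ (profile S (tails Cs))
    ≡⟨ cong₂ _+_ (∑-profiles n (tails-partition part) (φ ∘ bump h))
                 (∑-profiles n (tails-partition part) φ) ⟩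
  binoms (Vec.map ∣_∣ (tails Cs)) (φ ∘ bump h) + binoms (Vec.map ∣_∣ (tails Cs)) φ
    ≡⟨ binoms-bump (part zero) (Vec.map ∣_∣ (tails Cs)) φ ⟨
  binoms (bump h (Vec.map ∣_∣ (tails Cs))) φ
    ≡⟨ cong (λ ms → binoms ms φ) (sizes-bump Cs) ⟨
  binoms (Vec.map ∣_∣ Cs) φ ∎
  where
  open ≡-Reasoning
  sides = inside ∷ outside ∷ []
  h = membership zero Cs

sum-profile : ∀ {n} (S : Subset n) {Cs : Vec (Subset n) p} → Partition Cs →
              Vec.sum (profile S Cs) ≡ ∣ S ∣
sum-profile [] {Cs} part = empty Cs
  where
  empty : ∀ {p} (Cs : Vec (Subset 0) p) → Vec.sum (profile [] Cs) ≡ 0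
  empty []        = refl
  empty ([] ∷ Cs) = empty Cs
sum-profile (true ∷ S) {Cs} part = trans (cong Vec.sum (profile-inside S Cs))
  (trans (sum-bump (part zero) (profile S (tails Cs)))
         (cong suc (sum-profile S (tails-partition part))))
sum-profile (false ∷ S) {Cs} part = trans (cong Vec.sum (profile-outside S Cs))
  (sum-profile S (tails-partition part))

-- `α` and the number of components that meet a set.

elem≤sum : ∀ {k} {l : Vec ℕ p} → Any (k ≤_) l → k ≤ Vec.sum l
elem≤sum {l = l ∷ ls} (here k≤l)  = ≤-trans k≤l (m≤m+n l (Vec.sum ls))
elem≤sum {l = l ∷ ls} (there any) = ≤-trans (elem≤sum any) (m≤n+m (Vec.sum ls) l)

count≤sum : (l : Vec ℕ p) → Vec.count (λ lⱼ → ¬? (lⱼ ≟ 0)) l ≤ Vec.sum l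
count≤sum []           = z≤n
count≤sum (zero  ∷ ls) = count≤sum ls
count≤sum (suc l ∷ ls) = s≤s (≤-trans (count≤sum ls) (m≤n+m (Vec.sum ls) l))

-- An entry of at least `k` uses up the whole sum, so no other entry is positive. This is why the
-- tuples in `N′` may be restricted to entries below `k`.
α-concentrated : ∀ {k} {l : Vec ℕ p} → Any (k ≤_) l → Vec.sum l ≤ k → α l ≡ 0
α-concentrated any le = m≤n⇒m∸n≡0 (count≤1 any le)
  where
  rest≤0 : ∀ {k l s} → k ≤ l → l + s ≤ k → s ≤ 0
  rest≤0 {k} {l} {s} k≤l le = +-cancelˡ-≤ l s 0
    (≤-trans (≤-trans le k≤l) (≤-reflexive (sym (+-identityʳ l))))
  count≤1 : ∀ {p k} {l : Vec ℕ p} → Any (k ≤_) l → Vec.sum l ≤ k →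
            Vec.count (λ lⱼ → ¬? (lⱼ ≟ 0)) l ≤ 1
  count≤1 {l = zero  ∷ ls} (here k≤l)  le = m≤n⇒m≤1+n (≤-trans (count≤sum ls) (rest≤0 k≤l le))
  count≤1 {l = suc l ∷ ls} (here k≤l)  le = s≤s (≤-trans (count≤sum ls) (rest≤0 k≤l le))
  count≤1 {l = zero  ∷ ls} (there any) le = count≤1 any le
  -- An entry of the tail is already at least `k`, so a positive head would push the sum above `k`.
  count≤1 {k = k} {l = suc l ∷ ls} (there any) le =
    contradiction (≤-trans (s≤s (m≤n+m (Vec.sum ls) l)) (≤-trans le (elem≤sum any))) (<ⁿ-irrefl refl)

touches? : (S : Subset n) → U.Decidable (λ C → ∣ S ∩ C ∣ ≢ 0)
touches? S C = ¬? (∣ S ∩ C ∣ ≟ 0)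

touched : Graph n → Subset n → List (Subset n)
touched H S = filter (touches? S) (components H)

-- For `H = G ∖ B` and nonempty `S` this is the number c(B) - 1; for empty `S` it truncates to 0.
excess : Graph n → Subset n → ℕ
excess H S = length (touched H S) ∸ 1

α-profile : (S : Subset n) (L : List (Subset n)) →
            α (profile S (Vec.fromList L)) ≡ length (filter (touches? S) L) ∸ 1
α-profile S L = cong (_∸ 1) (go L)
  where
  go : ∀ L → Vec.count (λ l → ¬? (l ≟ 0)) (profile S (Vec.fromList L)) ≡ length (filter (touches? S) L)
  go []      = refl
  go (C ∷ L) with ∣ S ∩ C ∣
  ... | zero  = go L
  ... | suc _ = cong suc (go L)

-- Components as a partition, and `N′` as a sum of excesses.

∉⇒lookup≡false : ∀ {x} {D : Subset n} → ¬ x ∈ D → lookup D x ≡ false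
∉⇒lookup≡false {x = x} {D} x∉D with lookup D x in eq
... | true  = contradiction (lookup⇒[]= x D eq) x∉D
... | false = refl

-- A second true entry could only come from another copy of `D`, which `Unique L` rules out.
oneHot : ∀ {x} {D : Subset n} {L} → Unique L → D List∈.∈ L → x ∈ D →
         (∀ {D′} → D′ List∈.∈ L → x ∈ D′ → D′ ≡ D) → OneHot (membership x (Vec.fromList L))
oneHot {x = x} {D} {D ∷ L} (D≢ ∷ _) (here refl) x∈D only =
  subst OneHot (cong₂ _∷_ (sym ([]=⇒lookup x∈D))
                          (sym (none L (λ D′∈ x∈D′ → All.lookup D≢ D′∈ (sym (only (there D′∈) x∈D′))))))
        here
  where
  none : ∀ L → (∀ {D′} → D′ List∈.∈ L → ¬ x ∈ D′) →
         membership x (Vec.fromList L) ≡ Vec.replicate (length L) false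
  none []       _   = refl
  none (D ∷ L) out = cong₂ _∷_ (∉⇒lookup≡false (out (here refl))) (none L (out ∘ there))
oneHot {x = x} {D} {D₀ ∷ L} (D₀≢ ∷ uniq) (there D∈) x∈D only =
  subst (λ b → OneHot (b ∷ membership x (Vec.fromList L)))
        (sym (∉⇒lookup≡false (λ x∈D₀ → All.lookup D₀≢ D∈ (only (here refl) x∈D₀))))
        (there (oneHot uniq D∈ x∈D (only ∘ there)))

component⁻ : (H : Graph n) → ∀ {v w} → w ∈ component H v → Star (Adj H) v w
component⁻ H {v} = ∈-toSubset⁻ (star? (adj? H) v)

component⁺ : (H : Graph n) → ∀ {v w} → Star (Adj H) v w → w ∈ component H v
component⁺ H {v} = ∈-toSubset⁺ (star? (adj? H) v)

star-sym : (H : Graph n) → ∀ {v w} → Star (Adj H) v w → Star (Adj H) w v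
star-sym H = Star.reverse (adj-sym H)

component-≡ : (H : Graph n) → ∀ {v w} → Star (Adj H) v w → component H v ≡ component H w
component-≡ H v⋯w = ⊆-antisym
  (λ x∈ → component⁺ H (star-sym H v⋯w ◅◅ component⁻ H x∈))
  (λ x∈ → component⁺ H (v⋯w ◅◅ component⁻ H x∈))

component-≡⁻ : (H : Graph n) → ∀ {v w} → component H v ≡ component H w → Star (Adj H) v w
component-≡⁻ H eq = component⁻ H (subst (_ ∈_) (sym eq) (component⁺ H ε))

component-∈ : (H : Graph n) → ∀ v → component H v List∈.∈ components H
component-∈ H v = ∈-deduplicate⁺ (≡-dec _≟ᵇ_) (∈-map⁺ (component H) (∈-allFin v))

∈-components⁻ : (H : Graph n) → ∀ {D} → D List∈.∈ components H → ∃ λ v → D ≡ component H v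
∈-components⁻ {n} H D∈
  with ∈-map⁻ (component H) (∈-deduplicate⁻ (≡-dec _≟ᵇ_) (map (component H) (allFin n)) D∈)
... | v , _ , eq = v , eq

components-unique : (H : Graph n) → Unique (components H)
components-unique {n} H = deduplicate-! (≡-dec _≟ᵇ_) (map (component H) (allFin n))

components-partition : (H : Graph n) → Partition (Vec.fromList (components H))
components-partition H x =
  oneHot (components-unique H) (component-∈ H x) (component⁺ H ε) only
  where
  only : ∀ {D} → D List∈.∈ components H → x ∈ D → D ≡ component H x
  only D∈ x∈D with ∈-components⁻ H D∈
  ... | v , refl = component-≡ H (component⁻ H x∈D)

if≡0 : {P : Set} (P? : Dec P) {c : ℕ} → (P → c ≡ 0) → (if does P? then c else 0) ≡ 0
if≡0 (yes p) c≡0 = c≡0 p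
if≡0 (no _)  _   = refl

-- Grouping the sets of size `k` by profile turns the sum over sets into a sum over tuples weighted
-- by products of binomial coefficients.
N′≡∑-excess : ∀ k (H : Graph n) → N′ k H ≡ ∑ (subsetsOfSize n k) (excess H)
N′≡∑-excess {n} k H with 1 <ℕ? length (components H)
-- With at most one component every excess truncates to 0, in agreement with the default value of
-- `N′`.
... | no 1≮p = sym (∑-zero (subsetsOfSize n k) (λ S → m≤n⇒m∸n≡0
        (≤-trans (length-filter (touches? S) (components H)) (≮⇒≥ 1≮p))))
... | yes _ = sym (begin
  ∑ (subsetsOfSize n k) (excess H)
    ≡⟨ ∑-filter (λ S → ∣ S ∣ ≟ k) subsets (excess H) ⟩
  ∑[ S ← subsets ] (if does (∣ S ∣ ≟ k) then excess H S else 0)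
    ≡⟨ ∑-cong subsets (λ S _ → cong₂ (λ s e → if does (s ≟ k) then e else 0)
         (sym (sum-profile S part)) (sym (α-profile S (components H)))) ⟩
  ∑[ S ← subsets ] φ (profile S Ds)
    ≡⟨ ∑-profiles n part φ ⟩
  binoms sizes φ
    ≡⟨ binoms-expand k sizes φ φ≡0 ⟩
  ∑[ l ← tuples (upTo k) q ] (weight l * φ l)
    ≡⟨ ∑-cong (tuples (upTo k) q) (λ l _ → *-if (does (Vec.sum l ≟ k)) (weight l) (α l)) ⟩
  ∑[ l ← tuples (upTo k) q ] (if does (Vec.sum l ≟ k) then weight l * α l else 0)
    ≡⟨ ∑-filter (λ l → Vec.sum l ≟ k) (tuples (upTo k) q) (λ l → weight l * α l) ⟨
  N′-sizes k sizes ∎)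
  where
  open ≡-Reasoning
  q = length (components H)
  Ds = Vec.fromList (components H)
  part = components-partition H
  sizes = Vec.map ∣_∣ Ds
  subsets = tuples (inside ∷ outside ∷ []) n
  weight φ : Vec ℕ q → ℕ
  weight l = Vec.foldr (λ _ → ℕ) _*_ 1 (Vec.zipWith _choose_ sizes l)
  -- The size of `S` is the sum of its profile, so the filter by size can be absorbed into the
  -- summand.
  φ l = if does (Vec.sum l ≟ k) then α l else 0
  φ≡0 : ∀ l → Any (k ≤_) l → φ l ≡ 0
  φ≡0 l any = if≡0 (Vec.sum l ≟ k) (λ sum≡k → α-concentrated any (≤-reflexive sum≡k))
  *-if : ∀ b c d → c * (if b then d else 0) ≡ (if b then c * d else 0)
  *-if true  c d = refl
  *-if false c d = *-zeroʳ c

-- Nonseparable sets and blocks.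

_∈ˡ?_ : (x : Fin n) (xs : List (Fin n)) → Dec (x List∈.∈ xs)
_∈ˡ?_ = List∈?._∈?_ _≟ᶠ_

x∈p─q⇒x∉q : {p q : Subset n} {x : Fin n} → x ∈ p ─ q → x ∉ q
x∈p─q⇒x∉q {p = _ ∷ _} {inside ∷ _}  (there x∈) (there x∈q) = x∈p─q⇒x∉q x∈ x∈q
x∈p─q⇒x∉q {p = _ ∷ _} {outside ∷ _} (there x∈) (there x∈q) = x∈p─q⇒x∉q x∈ x∈q

x∈p-y⇒x≢y : {p : Subset n} {x y : Fin n} → x ∈ p - y → x ≢ y
x∈p-y⇒x≢y {y = y} x∈ refl = x∈p─q⇒x∉q x∈ (x∈⁅x⁆ y)

induced-sym : (G : Graph n) (X : Subset n) → ∀ {x y} → Star (G [ X ]) x y → Star (G [ X ]) y x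
induced-sym G X = Star.reverse (λ (x∈ , y∈ , a) → y∈ , x∈ , adj-sym G a)

induced-closed : (G : Graph n) {X : Subset n} → ∀ {x y} → Star (G [ X ]) x y → x ∈ X → y ∈ X
induced-closed G ε                 x∈ = x∈
induced-closed G ((_ , y∈ , _) ◅ s) _  = induced-closed G s y∈

clique-linked : (G : Graph n) {X Y : Subset n} → IsClique G X → ∀ {x y} →
                x ∈ X → y ∈ X → x ∈ Y → y ∈ Y → Star (G [ Y ]) x y
clique-linked G clique {x} {y} x∈X y∈X x∈Y y∈Y with x ≟ᶠ y
... | yes refl = ε
... | no  x≢y  = (x∈Y , y∈Y , clique x y x∈X y∈X x≢y) ◅ ε

clique-nonseparable : (G : Graph n) {X : Subset n} → IsClique G X → Nonempty X → IsNonseparable G X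
clique-nonseparable G {X} clique nonempty = record
  { nonempty    = nonempty
  ; connected   = λ x y x∈ y∈ → clique-linked G clique x∈ y∈ x∈ y∈
  ; noCutVertex = λ c (_ , x , y , x∈ , y∈ , _ , sep) →
      sep (clique-linked G clique (p─q⊆p X ⁅ c ⁆ x∈) (p─q⊆p X ⁅ c ⁆ y∈) x∈ y∈)
  }

induced? : (G : Graph n) (X : Subset n) → Decidable (G [ X ])
induced? G X x y = x ∈? X ×-dec y ∈? X ×-dec adj? G x y

cutVertex? : (G : Graph n) (X : Subset n) → U.Decidable (IsCutVertex G X)
cutVertex? G X c = c ∈? X ×-dec any? λ x → any? λ y →
  x ∈? (X - c) ×-dec y ∈? (X - c) ×-dec
  star? (induced? G X) x y ×-dec ¬? (star? (induced? G (X - c)) x y)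

nonseparable? : (G : Graph n) → U.Decidable (IsNonseparable G)
nonseparable? G X = map′
  (λ (ne , conn , nc) → record { nonempty = ne ; connected = conn ; noCutVertex = nc })
  (λ ns → let open IsNonseparable ns in nonempty , connected , noCutVertex)
  (nonempty? X ×-dec
   (all? λ x → all? λ y → x ∈? X →-dec y ∈? X →-dec star? (induced? G X) x y) ×-dec
   (all? λ c → ¬? (cutVertex? G X c)))

-- Passes to a strictly larger nonseparable set as long as one exists; `m` bounds the number of
-- vertices still outside `X` and serves as fuel for the recursion.
extend-to-block : (G : Graph n) → ∀ m (X : Subset n) → n ∸ ∣ X ∣ ≤ m → IsNonseparable G X →
                  ∃ λ W → IsBlock G W × X ⊆ W
extend-to-block {n} G m X bound ns
  with anySubset? (λ W → nonseparable? G W ×-dec X ⊆? W ×-dec ∣ X ∣ <ℕ? ∣ W ∣)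
... | no none = X , record { nonseparable = ns ; maximal = maximal } , id
  where
  maximal : ∀ W → IsNonseparable G W → X ⊆ W → W ⊆ X
  maximal W nsW X⊆W {x} x∈W with x ∈? X
  ... | yes x∈X = x∈X
  ... | no  x∉X = ⊥-elim (none (W , nsW , X⊆W , p⊂q⇒∣p∣<∣q∣ (X⊆W , x , x∈W , x∉X)))
-- No vertex is left outside `X`, so a larger set is impossible.
extend-to-block {n} G zero X bound ns | yes (W , _ , _ , X<W) =
  contradiction (≤-trans X<W (≤-trans (∣p∣≤n W) (m∸n≡0⇒m≤n (n≤0⇒n≡0 bound)))) (<ⁿ-irrefl refl)
extend-to-block {n} G (suc m) X bound ns | yes (W , nsW , X⊆W , X<W)
  with extend-to-block G m W
         (s≤s⁻¹ (<-≤-trans (∸-monoʳ-< X<W (∣p∣≤n W)) bound)) nsW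
... | B , isB , W⊆B = B , isB , W⊆B ∘ X⊆W

-- The two ends of an edge form a clique, hence a nonseparable set, which extends to a block.
edge-in-block : (G : Graph n) → ∀ {x y} → Adj G x y → ∃ λ W → IsBlock G W × x ∈ W × y ∈ W
edge-in-block {n} G {x} {y} a
  with extend-to-block G _ X ≤-refl (clique-nonseparable G clique (x , x∈X))
  where
  X = ⁅ x ⁆ ∪ ⁅ y ⁆
  x∈X : x ∈ X
  x∈X = x∈p∪q⁺ (inj₁ (x∈⁅x⁆ x))
  clique : IsClique G X
  clique u v u∈ v∈ u≢v with x∈p∪q⁻ ⁅ x ⁆ ⁅ y ⁆ u∈ | x∈p∪q⁻ ⁅ x ⁆ ⁅ y ⁆ v∈
  ... | inj₁ p | inj₁ q = contradiction (trans (x∈⁅y⁆⇒x≡y x p) (sym (x∈⁅y⁆⇒x≡y x q))) u≢v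
  ... | inj₂ p | inj₂ q = contradiction (trans (x∈⁅y⁆⇒x≡y y p) (sym (x∈⁅y⁆⇒x≡y y q))) u≢v
  ... | inj₁ p | inj₂ q rewrite x∈⁅y⁆⇒x≡y x p | x∈⁅y⁆⇒x≡y y q = a
  ... | inj₂ p | inj₁ q rewrite x∈⁅y⁆⇒x≡y y p | x∈⁅y⁆⇒x≡y x q = adj-sym G a
... | W , isB , X⊆W = W , isB ,
  X⊆W (x∈p∪q⁺ (inj₁ (x∈⁅x⁆ x))) , X⊆W (x∈p∪q⁺ (inj₂ (x∈⁅x⁆ y)))

-- Ears of a clique and the separation property of blocks.

module _ (G : Graph n) where

  -- The list of visited vertices is an index so that `cons` can forbid repetition. Simplicity
  -- matters in `branch`, where a deleted vertex must lie on one side only.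
  data Path : Fin n → Fin n → List (Fin n) → Set where
    stop : ∀ x → Path x x (x ∷ [])
    cons : ∀ {x y z xs} → Adj G x y → ¬ x List∈.∈ xs → Path y z xs → Path x z (x ∷ xs)

  start∈ : ∀ {x z xs} → Path x z xs → x List∈.∈ xs
  start∈ (stop x)        = here refl
  start∈ (cons _ _ _) = here refl

  end∈ : ∀ {x z xs} → Path x z xs → z List∈.∈ xs
  end∈ (stop x)        = here refl
  end∈ (cons _ _ P) = there (end∈ P)

  suffix : ∀ {y z xs x} → Path y z xs → x List∈.∈ xs →
           ∃ λ ys → Path x z ys × (∀ {w} → w List∈.∈ ys → w List∈.∈ xs)
  suffix (stop x)              (here refl) = _ , stop x , id
  suffix P@(cons _ _ _)     (here refl) = _ , P , id
  suffix (cons _ _ P)       (there x∈) with suffix P x∈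
  ... | ys , Q , ys⊆ = ys , Q , there ∘ ys⊆

  module _ (X : Subset n) where

    Outside : Rel (Fin n) 0ℓ
    Outside x y = x ∉ X × y ∉ X × Adj G x y

    -- Loop erasure: if the first vertex recurs on the path already found, the path is cut to its
    -- suffix from that recurrence.
    shortcut : ∀ {x z} → x ∉ X → Star Outside x z →
               ∃ λ xs → Path x z xs × (∀ {w} → w List∈.∈ xs → w ∉ X)
    shortcut {x} x∉X ε = x ∷ [] , stop x , λ { (here refl) → x∉X }
    shortcut {x} x∉X ((_ , y∉X , a) ◅ s) with shortcut y∉X s
    ... | xs , P , out with x ∈ˡ? xs
    ...   | no  x∉ = x ∷ xs , cons a x∉ P , λ { (here refl) → x∉X ; (there w∈) → out w∈ }
    ...   | yes x∈ with suffix P x∈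
    ...     | ys , Q , ys⊆ = ys , Q , out ∘ ys⊆

    -- The ear of an ear decomposition, with a walk for its interior that `shortcut` later turns
    -- into a path. The walk may be empty, which gives a single inner vertex.
    record Ear : Set where
      field
        {u v y z} : Fin n
        u∈X  : u ∈ X
        v∈X  : v ∈ X
        u≢v  : u ≢ v
        y∉X  : y ∉ X
        u~y  : Adj G u y
        y⋯z  : Star Outside y z
        z~v  : Adj G z v

    Exit : Fin n → Fin n → Set
    Exit x v = ∃ λ z → Star Outside x z × Adj G z v

    -- Induction along the walk. Each excursion out of `X` either returns to the vertex it left, and
    -- can be skipped, or to a different one, and is an ear. The second component follows an
    -- excursion in progress up to its first return `v′` to `X`.
    ear-or-≡ : ∀ {x v} → Star (Adj (G ∖ X)) x v → v ∈ X →
               (x ∈ X → x ≡ v ⊎ Ear) ×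
               (x ∉ X → ∃ λ v′ → v′ ∈ X × Exit x v′ × (v′ ≡ v ⊎ Ear))
    ear-or-≡ ε v∈ = (λ _ → inj₁ refl) , λ v∉ → contradiction v∈ v∉
    ear-or-≡ {x} {v} (_◅_ {j = y} (a , notBoth) s) v∈ = inside-case , outside-case
      where
      rec = ear-or-≡ s v∈
      inside-case : x ∈ X → x ≡ v ⊎ Ear
      inside-case x∈ with proj₂ rec (λ y∈ → notBoth (x∈ , y∈))
      ... | v′ , v′∈ , (z , y⋯z , z~v′) , r with x ≟ᶠ v′
      ...   | yes refl = r
      ...   | no  x≢v′ = inj₂ record
        { u∈X = x∈ ; v∈X = v′∈ ; u≢v = x≢v′ ; y∉X = λ y∈ → notBoth (x∈ , y∈)
        ; u~y = a ; y⋯z = y⋯z ; z~v = z~v′ }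
      outside-case : x ∉ X → ∃ λ v′ → v′ ∈ X × Exit x v′ × (v′ ≡ v ⊎ Ear)
      outside-case x∉ with y ∈? X
      ... | yes y∈ = y , y∈ , (x , ε , a) , proj₁ rec y∈
      ... | no  y∉ with proj₂ rec y∉
      ...   | v′ , v′∈ , (z , y⋯z , z~v′) , r =
        v′ , v′∈ , (z , (x∉ , y∉ , a) ◅ y⋯z , z~v′) , r

  along : ∀ {a b xs Y x} → Path a b xs → (∀ {w} → w List∈.∈ xs → w ∈ Y) →
          x List∈.∈ xs → Star (G [ Y ]) x b
  along (stop a)         _   (here refl) = ε
  along (cons a _ P) ⊆Y (here refl) =
    (⊆Y (here refl) , ⊆Y (there (start∈ P)) , a) ◅ along P (⊆Y ∘ there) (start∈ P)
  along (cons _ _ P) ⊆Y (there x∈)  = along P (⊆Y ∘ there) x∈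

  -- A simple path passes `c` at most once, so `c` blocks at most one of the two directions from
  -- `x`.
  branch : ∀ {a b xs Y c x} → Path a b xs → (∀ {w} → w List∈.∈ xs → w ∈ Y) →
           x List∈.∈ xs → x ≢ c → Star (G [ Y - c ]) x a ⊎ Star (G [ Y - c ]) x b
  branch (stop a)        _  (here refl) _ = inj₁ ε
  branch (cons _ _ _) _  (here refl) _ = inj₁ ε
  branch {a} {Y = Y} {c} (cons {xs = xs} a~a′ a∉ P) ⊆Y (there x∈) x≢c
    with branch P (⊆Y ∘ there) x∈ x≢c
  ... | inj₂ x⋯b = inj₂ x⋯b
  ... | inj₁ x⋯a′ with a ≟ᶠ c
  -- `c` is the first vertex of the path; by simplicity it is absent from the rest, which leads to
  -- `b`.
  ...   | yes refl = inj₂ (along P (λ w∈ → x∈p∧x≢y⇒x∈p-y (⊆Y (there w∈)) λ { refl → a∉ w∈ }) x∈)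
  ...   | no  a≢c  = inj₁ (x⋯a′ ◅◅
            (induced-closed G x⋯a′ (x∈p∧x≢y⇒x∈p-y (⊆Y (there x∈)) x≢c) ,
             x∈p∧x≢y⇒x∈p-y (⊆Y (here refl)) a≢c , adj-sym G a~a′) ◅ ε)

  -- After the deletion of any vertex `c`, each remaining vertex of the ear reaches the clique along
  -- one of the two arms, and what is left of the clique is still connected. For a block this
  -- contradicts maximality.
  ear-extends : (X : Subset n) → IsClique G X → Ear X →
                ∃ λ W → IsNonseparable G W × X ⊆ W × ∃ λ y → y ∈ W × y ∉ X
  ear-extends X clique ear with shortcut X (Ear.y∉X ear) (Ear.y⋯z ear)
  ... | xs , P , out = W , nonsep , X⊆W , y , path⊆W (start∈ P) , y∉X
    where
    open Ear ear
    W? : U.Decidable (λ x → x ∈ X ⊎ x List∈.∈ xs)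
    W? x = x ∈? X ⊎-dec x ∈ˡ? xs
    W = toSubset W?
    X⊆W : X ⊆ W
    X⊆W = ∈-toSubset⁺ W? ∘ inj₁
    path⊆W : ∀ {w} → w List∈.∈ xs → w ∈ W
    path⊆W = ∈-toSubset⁺ W? ∘ inj₂
    along-path : ∀ {Y x} → (∀ {w} → w List∈.∈ xs → w ∈ Y) → v ∈ Y → x List∈.∈ xs → Star (G [ Y ]) x v
    along-path ⊆Y v∈Y x∈ = along P ⊆Y x∈ ◅◅ (⊆Y (end∈ P) , v∈Y , z~v) ◅ ε
    avoid : ∀ {c} → c ∈ X → ∀ {w} → w List∈.∈ xs → w ∈ W - c
    avoid c∈X w∈ = x∈p∧x≢y⇒x∈p-y (path⊆W w∈) λ { refl → out w∈ c∈X }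
    anchor : ∀ {c x} → x ∈ W - c → x ≢ c → ∃ λ w → w ∈ X × w ∈ W - c × Star (G [ W - c ]) x w
    anchor {c} {x} x∈ x≢c with ∈-toSubset⁻ W? (p─q⊆p W ⁅ c ⁆ x∈)
    ... | inj₁ x∈X = x , x∈X , x∈ , ε
    ... | inj₂ x∈P with branch P path⊆W x∈P x≢c
    ...   | inj₁ x⋯y with u ≟ᶠ c
    ...     | no  u≢c  = u , u∈X , x∈p∧x≢y⇒x∈p-y (X⊆W u∈X) u≢c ,
              x⋯y ◅◅ (induced-closed G x⋯y x∈ , x∈p∧x≢y⇒x∈p-y (X⊆W u∈X) u≢c , adj-sym G u~y) ◅ ε
    -- Here `c` is the foot `u` of the arm and lies off the path, so the path can be followed to `v`
    -- instead.
    ...     | yes refl = v , v∈X , v∈W-c , along-path (avoid u∈X) v∈W-c x∈P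
      where v∈W-c = x∈p∧x≢y⇒x∈p-y (X⊆W v∈X) (u≢v ∘ sym)
    anchor {c} {x} x∈ x≢c | inj₂ x∈P | inj₂ x⋯z with v ≟ᶠ c
    ...     | no  v≢c  = v , v∈X , x∈p∧x≢y⇒x∈p-y (X⊆W v∈X) v≢c ,
              x⋯z ◅◅ (induced-closed G x⋯z x∈ , x∈p∧x≢y⇒x∈p-y (X⊆W v∈X) v≢c , z~v) ◅ ε
    ...     | yes refl = u , u∈X , u∈W-c , along P (avoid v∈X) x∈P ◅◅
              induced-sym G (W - c) ((u∈W-c , avoid v∈X (start∈ P) , u~y) ◅ along P (avoid v∈X) (start∈ P))
      where u∈W-c = x∈p∧x≢y⇒x∈p-y (X⊆W u∈X) u≢v
    to-v : ∀ {x} → x ∈ W → Star (G [ W ]) x v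
    to-v x∈ with ∈-toSubset⁻ W? x∈
    ... | inj₁ x∈X = clique-linked G clique x∈X v∈X x∈ (X⊆W v∈X)
    ... | inj₂ x∈P = along-path path⊆W (X⊆W v∈X) x∈P
    nonsep : IsNonseparable G W
    nonsep = record
      { nonempty    = u , X⊆W u∈X
      ; connected   = λ x y x∈ y∈ → to-v x∈ ◅◅ induced-sym G W (to-v y∈)
      ; noCutVertex = λ c (_ , x , y , x∈ , y∈ , _ , sep) →
          let (a , a∈X , a∈W , x⋯a) = anchor x∈ (x∈p-y⇒x≢y x∈)
              (b , b∈X , b∈W , y⋯b) = anchor y∈ (x∈p-y⇒x≢y y∈)
          in sep (x⋯a ◅◅ clique-linked G clique a∈X b∈X a∈W b∈W ◅◅ induced-sym G (W - c) y⋯b)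
      }

  -- If `u` and `v` differed, the walk would contain an ear, and the block together with this ear
  -- would lie in a larger nonseparable set.
  block-separates : {X : Subset n} → IsBlock G X → IsClique G X → ∀ {u v} → u ∈ X → v ∈ X →
                    Star (Adj (G ∖ X)) u v → u ≡ v
  block-separates {X} isB clique u∈ v∈ s with proj₁ (ear-or-≡ X s v∈) u∈
  ... | inj₁ u≡v = u≡v
  ... | inj₂ ear with ear-extends X clique ear
  ...   | W , nsW , X⊆W , y , y∈W , y∉X = contradiction (IsBlock.maximal isB W nsW X⊆W y∈W) y∉X

  -- A vertex `w` of `Y` outside `X` would give a walk `u`, `w`, `v` that uses no edge inside `X`,
  -- contrary to `block-separates`.
  block-⊆ : {X Y : Subset n} → IsBlock G X → IsClique G X → IsClique G Y → ∀ {u v} → u ≢ v →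
            u ∈ X → v ∈ X → u ∈ Y → v ∈ Y → Y ⊆ X
  block-⊆ {X} isB cliqueX cliqueY {u} {v} u≢v u∈X v∈X u∈Y v∈Y {w} w∈Y with w ∈? X
  ... | yes w∈X = w∈X
  ... | no  w∉X = contradiction
    (block-separates isB cliqueX u∈X v∈X
      ((cliqueY u w u∈Y w∈Y (λ { refl → w∉X u∈X }) , w∉X ∘ proj₂) ◅
       (cliqueY w v w∈Y v∈Y (λ { refl → w∉X v∈X }) , w∉X ∘ proj₁) ◅ ε))
    u≢v

  blocks-share-edge : {X Y : Subset n} → IsBlock G X → IsBlock G Y → IsClique G X → IsClique G Y →
            ∀ {u v} → u ≢ v → u ∈ X → v ∈ X → u ∈ Y → v ∈ Y → X ≡ Y
  blocks-share-edge isX isY cX cY u≢v u∈X v∈X u∈Y v∈Y = ⊆-antisym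
    (block-⊆ isY cY cX u≢v u∈Y v∈Y u∈X v∈X)
    (block-⊆ isX cX cY u≢v u∈X v∈X u∈Y v∈Y)

-- Counting in duplicate-free lists.

unique-⊆⇒length≤ : {xs ys : List A} → Unique xs → (∀ {x} → x List∈.∈ xs → x List∈.∈ ys) →
                   length xs ≤ length ys
unique-⊆⇒length≤ {xs = []}     _             _  = z≤n
unique-⊆⇒length≤ {xs = x ∷ xs} (x≢ ∷ uniq) sub with ∈-∃++ (sub (here refl))
... | as , bs , refl = ≤-trans
  (s≤s (unique-⊆⇒length≤ uniq drop-x)) (≤-reflexive (sym (length-++-sucʳ as x bs)))
  where
  drop-x : ∀ {y} → y List∈.∈ xs → y List∈.∈ as ++ bs
  drop-x y∈ with ∈-++⁻ as (sub (there y∈))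
  ... | inj₁ y∈as          = ∈-++⁺ˡ y∈as
  ... | inj₂ (here refl)   = contradiction refl (All.lookup x≢ y∈)
  ... | inj₂ (there y∈bs)  = ∈-++⁺ʳ as y∈bs

unique-map : (f : A → A′) {xs : List A} → Unique xs →
             (∀ {x y} → x List∈.∈ xs → y List∈.∈ xs → f x ≡ f y → x ≡ y) → Unique (map f xs)
unique-map f []            inj = []
unique-map f (x≢ ∷ uniq) inj =
  All.map⁺ (All.tabulate λ y∈ fx≡fy → All.lookup x≢ y∈ (inj (here refl) (there y∈) fx≡fy))
  ∷ unique-map f uniq (λ x∈ y∈ → inj (there x∈) (there y∈))

constant⇒length≤1 : {xs : List A} → Unique xs →
                    (∀ {x y} → x List∈.∈ xs → y List∈.∈ xs → x ≡ y) → length xs ≤ 1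
constant⇒length≤1 {xs = []}        _                    _  = z≤n
constant⇒length≤1 {xs = _ ∷ []}    _                    _  = s≤s z≤n
constant⇒length≤1 {xs = _ ∷ _ ∷ _} ((x≢y ∷ _) ∷ _) eq =
  contradiction (eq (here refl) (there (here refl))) x≢y

length-concatMap : (f : A → List A′) (xs : List A) → length (concatMap f xs) ≡ ∑ xs (length ∘ f)
length-concatMap f []       = refl
length-concatMap f (x ∷ xs) = trans (length-++ (f x)) (cong (length (f x) +_) (length-concatMap f xs))

-- A choice of representatives: when `f` sends a vertex to its component, it yields one vertex of
-- `S` for each component that meets `S`.
preimages : {P : U.Pred A 0ℓ} (f : A → A′) (ys : List A′) →
            (∀ {y} → y List∈.∈ ys → ∃ λ x → P x × y ≡ f x) → ∃ λ xs → map f xs ≡ ys × All P xs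
preimages f []       pre = [] , refl , []
preimages f (y ∷ ys) pre with pre (here refl) | preimages f ys (pre ∘ there)
... | x , px , refl | xs , refl , pxs = x ∷ xs , refl , px ∷ pxs

-- Merging classes along a list of pairs.

Joins : List (A × A) → Rel A 0ℓ
Joins F x y = (x , y) List∈.∈ F ⊎ (y , x) List∈.∈ F

module _ (_≟′_ : DecidableEquality A′) where

  -- The labels `f x` are pairwise distinct, so at most one element carries the label `c`.
  remove-class : (f : A → A′) (c : A′) {xs : List A} → AllPairs (λ x y → f x ≢ f y) xs →
                 length xs ≤ suc (length (filter (λ x → ¬? (f x ≟′ c)) xs))
  remove-class f c []                     = z≤n
  remove-class f c {x ∷ xs} (x≢ ∷ pairs) with f x ≟′ c
  ... | no  _    = s≤s (remove-class f c pairs)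
  ... | yes refl = s≤s (≤-reflexive (sym (cong length
                     (filter-all (λ y → ¬? (f y ≟′ f x)) (All.map (_∘ sym) x≢)))))

  -- Adding the pairs of F one at a time, each merges two classes of f and so
  -- costs at most one representative.
  representatives-bound : (F : List (A × A)) (f : A → A′) (xs : List A) →
    AllPairs (λ x y → f x ≢ f y) xs →
    (∀ {x y} → x List∈.∈ xs → y List∈.∈ xs → Star (λ x y → f x ≡ f y ⊎ Joins F x y) x y) →
    length xs ≤ suc (length F)
  representatives-bound []            f []          _                 _    = z≤n
  representatives-bound []            f (_ ∷ [])    _                 _    = s≤s z≤n
  representatives-bound []            f (x ∷ y ∷ _) ((x≢y ∷ _) ∷ _) link =
    contradiction (same (link (here refl) (there (here refl)))) x≢y
    where
    same : ∀ {x y} → Star (λ x y → f x ≡ f y ⊎ Joins [] x y) x y → f x ≡ f y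
    same ε                     = refl
    same (inj₁ eq        ◅ s) = trans eq (same s)
    same (inj₂ (inj₁ ()) ◅ s)
    same (inj₂ (inj₂ ()) ◅ s)
  representatives-bound {A} ((a , b) ∷ F) f xs pairs link = ≤-trans
    (remove-class f (f b) pairs)
    (s≤s (representatives-bound F (merge ∘ f) xs′ pairs′
      (λ x∈ y∈ → Star.map weaken
        (link (proj₁ (∈-filter⁻ P? {xs = xs} x∈)) (proj₁ (∈-filter⁻ P? {xs = xs} y∈))))))
    where
    P? = λ (x : A) → ¬? (f x ≟′ f b)
    xs′ = filter P? xs
    -- The class of `b` is renamed to that of `a`, which makes the pair `(a , b)` an equality of
    -- labels.
    merge : A′ → A′
    merge c with c ≟′ f b
    ... | yes _ = f a
    ... | no  _ = c
    merge-fixes : ∀ {c} → c ≢ f b → merge c ≡ c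
    merge-fixes {c} c≢ with c ≟′ f b
    ... | yes c≡ = contradiction c≡ c≢
    ... | no  _  = refl
    merge-ab : merge (f a) ≡ merge (f b)
    merge-ab with f a ≟′ f b | f b ≟′ f b
    ... | yes _ | yes _ = refl
    ... | no  _ | yes _ = refl
    ... | _     | no ≢  = contradiction refl ≢
    -- No remaining representative has the label `f b`, so merging leaves all their labels unchanged
    -- and distinct.
    pairs′ : AllPairs (λ x y → merge (f x) ≢ merge (f y)) xs′
    pairs′ = go xs′ (λ x∈ → proj₂ (∈-filter⁻ P? {xs = xs} x∈)) (AllPairs.filter⁺ P? pairs)
      where
      go : ∀ ys → (∀ {y} → y List∈.∈ ys → f y ≢ f b) → AllPairs (λ x y → f x ≢ f y) ys →
           AllPairs (λ x y → merge (f x) ≢ merge (f y)) ys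
      go []       _   []         = []
      go (y ∷ ys) ≢fb (y≢ ∷ ps) =
        All.tabulate (λ {z} z∈ eq → All.lookup y≢ z∈
          (trans (sym (merge-fixes (≢fb (here refl)))) (trans eq (merge-fixes (≢fb (there z∈))))))
        ∷ go ys (≢fb ∘ there) ps
    weaken : ∀ {x y} → f x ≡ f y ⊎ Joins ((a , b) ∷ F) x y →
             merge (f x) ≡ merge (f y) ⊎ Joins F x y
    weaken (inj₁ eq)                  = inj₁ (cong merge eq)
    weaken (inj₂ (inj₁ (here refl))) = inj₁ merge-ab
    weaken (inj₂ (inj₁ (there e)))   = inj₂ (inj₁ e)
    weaken (inj₂ (inj₂ (here refl))) = inj₁ (sym merge-ab)
    weaken (inj₂ (inj₂ (there e)))   = inj₂ (inj₂ e)

-- Touched components, lists of edges and stars.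

∣p∣≢0⇒nonempty : (X : Subset n) → ∣ X ∣ ≢ 0 → Nonempty X
∣p∣≢0⇒nonempty {n} X ≢0 with nonempty? X
... | yes ne = ne
... | no  e  = contradiction (trans (cong ∣_∣ (Empty-unique e)) (∣⊥∣≡0 n)) ≢0

∈⇒∣p∣≢0 : (X : Subset n) {x : Fin n} → x ∈ X → ∣ X ∣ ≢ 0
∈⇒∣p∣≢0 X {x} x∈ ≡0 with ∣ X ∣ | ≡0 | x∈p⇒∣p-x∣<∣p∣ x∈
... | _ | refl | ()

touched-label : (H : Graph n) (S : Subset n) → ∀ {D} → D List∈.∈ touched H S →
                ∃ λ s → s ∈ S × D ≡ component H s
touched-label H S {D} D∈ with ∈-filter⁻ (touches? S) {xs = components H} D∈
... | D∈H , meets with ∣p∣≢0⇒nonempty (S ∩ D) meets | ∈-components⁻ H D∈H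
...   | s , s∈ | v , refl with x∈p∩q⁻ S D s∈
...     | s∈S , s∈D = s , s∈S , component-≡ H (component⁻ H s∈D)

component∈touched : (H : Graph n) {S : Subset n} → ∀ {s x} → s ∈ S → Star (Adj H) s x →
                    component H x List∈.∈ touched H S
component∈touched H {S} {s} {x} s∈ s⋯x = ∈-filter⁺ (touches? S) (component-∈ H x)
  (∈⇒∣p∣≢0 (S ∩ component H x) (x∈p∩q⁺ (s∈ , component⁺ H (star-sym H s⋯x))))

edges : EdgeSet n → List (Fin n × Fin n)
edges {n} E = filter (λ (x , y) → (x <? y) ×-dec edge? E x y) (cartesianProduct (allFin n) (allFin n))

edges⁺ : (E : EdgeSet n) → ∀ {x y} → x < y → Edge E x y → (x , y) List∈.∈ edges E
edges⁺ E x<y e = ∈-filter⁺ (λ (x , y) → (x <? y) ×-dec edge? E x y)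
  (∈-cartesianProduct⁺ (∈-allFin _) (∈-allFin _)) (x<y , e)

edges⁻ : (E : EdgeSet n) → ∀ {x y} → (x , y) List∈.∈ edges E → x < y × Edge E x y
edges⁻ {n} E xy∈ = proj₂ (∈-filter⁻ (λ (x , y) → (x <? y) ×-dec edge? E x y)
  {xs = cartesianProduct (allFin n) (allFin n)} xy∈)

edges-unique : (E : EdgeSet n) → Unique (edges E)
edges-unique {n} E = Unique.filter⁺ (λ (x , y) → (x <? y) ×-dec edge? E x y)
  (Unique.cartesianProduct⁺ (Unique.allFin⁺ n) (Unique.allFin⁺ n))

orient : Fin n × Fin n → Fin n × Fin n
orient (x , y) with x <? y
... | yes _ = x , y
... | no  _ = y , x

orient-< : {x y : Fin n} → x < y → orient (x , y) ≡ (x , y)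
orient-< {x = x} {y} x<y with x <? y
... | yes _   = refl
... | no  x≮y = contradiction x<y x≮y

orient-> : {x y : Fin n} → y < x → orient (x , y) ≡ (y , x)
orient-> {x = x} {y} y<x with x <? y
... | yes x<y = contradiction y<x (<-asym x<y)
... | no  _   = refl

-- `edges E` is duplicate-free with the smaller end first, so it is contained in the list of the
-- pairs of `F` oriented likewise.
edgeCount-bound : (E : EdgeSet n) (F : List (Fin n × Fin n)) →
                  (∀ {x y} → Edge E x y → Joins F x y) → edgeCount E ≤ length F
edgeCount-bound E F joins = ≤-trans (unique-⊆⇒length≤ (edges-unique E) sub)
                                    (≤-reflexive (length-map orient F))
  where
  sub : ∀ {e} → e List∈.∈ edges E → e List∈.∈ map orient F
  sub {x , y} e∈ with edges⁻ E e∈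
  ... | x<y , e with joins e
  ...   | inj₁ xy∈ = subst (List∈._∈ _) (orient-< x<y) (∈-map⁺ orient xy∈)
  ...   | inj₂ yx∈ = subst (List∈._∈ _) (orient-> x<y) (∈-map⁺ orient yx∈)

-- The star centred at the head of the list; it will join the chosen vertices of one block.
spokes : List A → List (A × A)
spokes []       = []
spokes (r ∷ rs) = map (r ,_) rs

length-spokes : (xs : List A) → length (spokes xs) ≡ length xs ∸ 1
length-spokes []       = refl
length-spokes (r ∷ rs) = length-map (r ,_) rs

spokes⁻ : {xs : List A} → Unique xs → ∀ {x y} → (x , y) List∈.∈ spokes xs →
          x ≢ y × x List∈.∈ xs × y List∈.∈ xs
spokes⁻ {xs = r ∷ rs} (r≢ ∷ _) xy∈ with ∈-map⁻ (r ,_) xy∈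
... | _ , y∈ , refl = All.lookup r≢ y∈ , here refl , there y∈

spokes-link : {xs : List A} → ∀ {x y} → x List∈.∈ xs → y List∈.∈ xs → Star (Joins (spokes xs)) x y
spokes-link {xs = r ∷ rs} x∈ y∈ = Star.reverse swap (from-centre x∈) ◅◅ from-centre y∈
  where
  from-centre : ∀ {x} → x List∈.∈ r ∷ rs → Star (Joins (spokes (r ∷ rs))) r x
  from-centre (here refl) = ε
  from-centre (there x∈)  = inj₁ (∈-map⁺ (r ,_) x∈) ◅ ε

-- The Steiner distance computed block by block.

module BlockSystem (G : Graph n) (B : Fin t → Subset n)
  (clique    : ∀ i → IsClique G (B i))
  (separates : ∀ i {x y} → x ∈ B i → y ∈ B i → Star (Adj (G ∖ B i)) x y → x ≡ y)
  (cover     : ∀ {x y} → Adj G x y → ∃ λ i → x ∈ B i × y ∈ B i)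
  (disjoint  : ∀ {i j x y} → x ≢ y → x ∈ B i → y ∈ B i → x ∈ B j → y ∈ B j → i ≡ j)
  where

  adj⇒≢ : ∀ {x y} → Adj G x y → x ≢ y
  adj⇒≢ a refl = irrefl G a

  inBlock? : ∀ i → U.Decidable (λ ((x , y) : Fin n × Fin n) → x ∈ B i × y ∈ B i)
  inBlock? i (x , y) = x ∈? B i ×-dec y ∈? B i

  module LowerBound (S V : Subset n) (E : EdgeSet n) (sub : IsSubgraph G V E)
                    (linked : Linked V (Edge E)) (S⊆V : S ⊆ V) where

    -- One vertex of `S` is chosen in each touched component of `G ∖ B i`. The edges of `E` link
    -- them, and every such edge either stays inside a component or lies in `B i`, so
    -- `representatives-bound` applies.
    excess≤block-edges : ∀ i → excess (G ∖ B i) S ≤ length (filter (inBlock? i) (edges E))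
    excess≤block-edges i
      with preimages {P = _∈ S} (component H) (touched H S) (touched-label H S)
      where H = G ∖ B i
    ... | xs , eq , xs⊆S = ∸-monoˡ-≤ 1 (≤-trans
      (≤-reflexive (trans (cong length (sym eq)) (length-map (component H) xs)))
      (representatives-bound (≡-dec _≟ᵇ_) Eᵢ (component H) xs
        (AllPairs.map⁻ (subst Unique (sym eq) (Unique.filter⁺ (touches? S) (components-unique H))))
        (λ x∈ y∈ → Star.map step (linked _ _ (S⊆V (All.lookup xs⊆S x∈)) (S⊆V (All.lookup xs⊆S y∈))))))
      where
      H = G ∖ B i
      Eᵢ = filter (inBlock? i) (edges E)
      step : ∀ {x y} → Edge E x y → component H x ≡ component H y ⊎ Joins Eᵢ x y
      step {x} {y} e with sub x y e | inBlock? i (x , y)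
      ... | a , _ , _ | no  notBoth = inj₁ (component-≡ H ((a , notBoth) ◅ ε))
      ... | a , e′ , _ | yes (x∈ , y∈) with <-cmp x y
      ...   | tri< x<y _ _ = inj₂ (inj₁ (∈-filter⁺ (inBlock? i) (edges⁺ E x<y e) (x∈ , y∈)))
      ...   | tri≈ _ x≡y _ = contradiction x≡y (adj⇒≢ a)
      ...   | tri> _ _ y<x = inj₂ (inj₂ (∈-filter⁺ (inBlock? i) (edges⁺ E y<x e′) (y∈ , x∈)))

    -- Double counting of the pairs of a block and an edge of `E` in it; by `disjoint` an edge is
    -- counted at most once.
    lower-bound : ∑[ i ← allFin t ] excess (G ∖ B i) S ≤ edgeCount E
    lower-bound = begin
      ∑[ i ← allFin t ] excess (G ∖ B i) S
        ≤⟨ ∑-mono (allFin t) (λ i _ → excess≤block-edges i) ⟩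
      ∑[ i ← allFin t ] length (filter (inBlock? i) (edges E))
        ≡⟨ ∑-cong (allFin t) (λ i _ → length-filter≡∑ (inBlock? i) (edges E)) ⟩
      ∑[ i ← allFin t ] ∑[ e ← edges E ] (if does (inBlock? i e) then 1 else 0)
        ≡⟨ ∑-swap (allFin t) (edges E) _ ⟩
      ∑[ e ← edges E ] ∑[ i ← allFin t ] (if does (inBlock? i e) then 1 else 0)
        ≤⟨ ∑-mono (edges E) one-block ⟩
      ∑[ e ← edges E ] 1
        ≡⟨ ∑-const (edges E) ⟩
      length (edges E) ∎
      where
      open ≤-Reasoning
      ∑-const : ∀ (xs : List (Fin n × Fin n)) → ∑[ x ← xs ] 1 ≡ length xs
      ∑-const []       = refl
      ∑-const (x ∷ xs) = cong suc (∑-const xs)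
      one-block : ∀ e → e List∈.∈ edges E → ∑[ i ← allFin t ] (if does (inBlock? i e) then 1 else 0) ≤ 1
      one-block e@(x , y) e∈ = ≤-trans
        (≤-reflexive (sym (length-filter≡∑ (λ i → inBlock? i e) (allFin t))))
        (constant⇒length≤1 (Unique.filter⁺ (λ i → inBlock? i e) (Unique.allFin⁺ t)) λ i∈ j∈ →
          let (x∈Bᵢ , y∈Bᵢ) = proj₂ (∈-filter⁻ (λ i → inBlock? i e) {xs = allFin t} i∈)
              (x∈Bⱼ , y∈Bⱼ) = proj₂ (∈-filter⁻ (λ i → inBlock? i e) {xs = allFin t} j∈)
          in disjoint (λ { refl → <-irrefl refl (proj₁ (edges⁻ E e∈)) }) x∈Bᵢ y∈Bᵢ x∈Bⱼ y∈Bⱼ)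

  -- The list records the block of each step in order. As it has no repetition, the part of a route
  -- after its step in block `i` avoids the edges of `B i`.
  data Route : Fin n → Fin n → List (Fin t) → Set where
    stop : ∀ {x} → Route x x []
    cons : ∀ {x y z i js} → Adj G x y → x ∈ B i → y ∈ B i → ¬ i List∈.∈ js →
           Route y z js → Route x z (i ∷ js)

  leave-block : ∀ {y z i js} → Route y z js → i List∈.∈ js →
                ∃ λ w → ∃ λ ks → w ∈ B i × ¬ i List∈.∈ ks × Route w z ks
  leave-block (cons _ _ y∈ i∉ R) (here refl) = _ , _ , y∈ , i∉ , R
  leave-block (cons _ _ _  _  R) (there i∈)  = leave-block R i∈

  -- If the block of the new first edge recurs later, everything up to and including that later step
  -- is replaced by one edge of the clique, or by nothing when the step ends at `x`.
  route : ∀ {x z} → Star (Adj G) x z → ∃ (Route x z)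
  route ε = [] , stop
  route {x} (a ◅ s) with cover a | route s
  ... | i , x∈ , y∈ | js , R with i ∈ˡ? js
  ...   | no  i∉ = i ∷ js , cons a x∈ y∈ i∉ R
  ...   | yes i∈ with leave-block R i∈
  ...     | w , ks , w∈ , i∉ks , Q with x ≟ᶠ w
  ...       | yes refl = ks , Q
  ...       | no  x≢w  = i ∷ ks , cons (clique i x w x∈ w∈ x≢w) x∈ w∈ i∉ks Q

  step-outside : ∀ {i j x y} → i ≢ j → Adj G x y → x ∈ B i → y ∈ B i → Adj (G ∖ B j) x y
  step-outside i≢j a x∈ y∈ = a , λ (x∈′ , y∈′) → i≢j (disjoint (adj⇒≢ a) x∈ y∈ x∈′ y∈′)

  route-outside : ∀ {x z j js} → ¬ j List∈.∈ js → Route x z js → Star (Adj (G ∖ B j)) x z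
  route-outside j∉ stop              = ε
  route-outside j∉ (cons a x∈ y∈ _ R) =
    step-outside (λ { refl → j∉ (here refl) }) a x∈ y∈ ◅ route-outside (j∉ ∘ there) R

  module UpperBound (S : Subset n) where

    -- By `separates`, a gate is the only vertex of `B i` in its component of `G ∖ B i`, so distinct
    -- gates stand for distinct touched components.
    Gate : Fin t → Fin n → Set
    Gate i x = x ∈ B i × ∃ λ s → s ∈ S × Star (Adj (G ∖ B i)) s x

    gate? : ∀ i → U.Decidable (Gate i)
    gate? i x = x ∈? B i ×-dec any? λ s → s ∈? S ×-dec star? (adj? (G ∖ B i)) s x

    gates : Fin t → List (Fin n)
    gates i = filter (gate? i) (allFin n)

    gates⁻ : ∀ {i x} → x List∈.∈ gates i → Gate i x
    gates⁻ {i} x∈ = proj₂ (∈-filter⁻ (gate? i) {xs = allFin n} x∈)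

    gates-unique : ∀ i → Unique (gates i)
    gates-unique i = Unique.filter⁺ (gate? i) (Unique.allFin⁺ n)

    gates≤touched : ∀ i → length (gates i) ≤ length (touched (G ∖ B i) S)
    gates≤touched i = ≤-trans (≤-reflexive (sym (length-map (component H) (gates i))))
      (unique-⊆⇒length≤ (unique-map (component H) (gates-unique i) inj) sub)
      where
      H = G ∖ B i
      inj : ∀ {x y} → x List∈.∈ gates i → y List∈.∈ gates i → component H x ≡ component H y → x ≡ y
      inj x∈ y∈ eq = separates i (proj₁ (gates⁻ x∈)) (proj₁ (gates⁻ y∈)) (component-≡⁻ H eq)
      sub : ∀ {D} → D List∈.∈ map (component H) (gates i) → D List∈.∈ touched H S
      sub D∈ with ∈-map⁻ (component H) D∈
      ... | x , x∈ , refl with gates⁻ x∈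
      ...   | _ , s , s∈ , s⋯x = component∈touched H s∈ s⋯x

    treeEdges : List (Fin n × Fin n)
    treeEdges = concatMap (spokes ∘ gates) (allFin t)

    treeEdges-bound : length treeEdges ≤ ∑[ i ← allFin t ] excess (G ∖ B i) S
    treeEdges-bound = ≤-trans (≤-reflexive (length-concatMap (spokes ∘ gates) (allFin t)))
      (∑-mono (allFin t) (λ i _ → ≤-trans (≤-reflexive (length-spokes (gates i)))
                                          (∸-monoˡ-≤ 1 (gates≤touched i))))

    Tree : Rel (Fin n) 0ℓ
    Tree = Joins treeEdges

    tree? : Decidable Tree
    tree? x y = (x , y) ∈ᵉ? treeEdges ⊎-dec (y , x) ∈ᵉ? treeEdges
      where _∈ᵉ?_ = List∈?._∈?_ (Product.≡-dec _≟ᶠ_ _≟ᶠ_)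

    treeEdge⇒adj : ∀ {x y} → (x , y) List∈.∈ treeEdges → Adj G x y
    treeEdge⇒adj e∈ with Any.satisfied (∈-concatMap⁻ (spokes ∘ gates) {xs = allFin t} e∈)
    ... | i , e∈ᵢ with spokes⁻ (gates-unique i) e∈ᵢ
    ...   | x≢y , x∈ , y∈ = clique i _ _ (proj₁ (gates⁻ x∈)) (proj₁ (gates⁻ y∈)) x≢y

    tree⇒adj : ∀ {x y} → Tree x y → Adj G x y
    tree⇒adj (inj₁ e) = treeEdge⇒adj e
    tree⇒adj (inj₂ e) = adj-sym G (treeEdge⇒adj e)

    gates-linked : ∀ {i x y} → Gate i x → Gate i y → Star Tree x y
    gates-linked {i} gx gy = Star.map widen (spokes-link (gate∈ gx) (gate∈ gy))
      where
      gate∈ : ∀ {x} → Gate i x → x List∈.∈ gates i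
      gate∈ g = ∈-filter⁺ (gate? i) (∈-allFin _) g
      into : ∀ {e} → e List∈.∈ spokes (gates i) → e List∈.∈ treeEdges
      into e∈ = ∈-concatMap⁺ (spokes ∘ gates) (Any.map (λ { refl → e∈ }) (∈-allFin i))
      widen : ∀ {x y} → Joins (spokes (gates i)) x y → Tree x y
      widen (inj₁ e) = inj₁ (into e)
      widen (inj₂ e) = inj₂ (into e)

    -- `behind` says that `s` reaches `x` while avoiding the edges of any one block still ahead.
    -- Hence, on crossing block `i`, `x` is a gate reached from `s` and `y` a gate reached from `z`,
    -- and the star of that block joins them.
    along-route : ∀ {s x z js} → s ∈ S → z ∈ S → Route x z js →
                  (∀ {j} → j List∈.∈ js → Star (Adj (G ∖ B j)) s x) → Star Tree x z
    along-route s∈ z∈ stop _ = ε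
    along-route {s} {z = z} s∈ z∈ (cons {i = i} a x∈ y∈ i∉ R) behind =
      gates-linked (x∈ , s , s∈ , behind (here refl))
                   (y∈ , z , z∈ , star-sym (G ∖ B i) (route-outside i∉ R)) ◅◅
      -- The edge just crossed lies in block `i`, so it is not an edge of any later block `j`.
      along-route s∈ z∈ R (λ j∈ → behind (there j∈) ◅◅
        step-outside (λ { refl → i∉ j∈ }) a x∈ y∈ ◅ ε)

    terminals-linked : Connected G → ∀ {s z} → s ∈ S → z ∈ S → Star Tree s z
    terminals-linked conn s∈ z∈ with route (conn _ _)
    ... | _ , R = along-route s∈ z∈ R (λ _ → ε)

    upper-bound : Connected G → Nonempty S →
                  ∃ λ m → Connects G S m × m ≤ ∑[ i ← allFin t ] excess (G ∖ B i) S
    upper-bound conn (s₀ , s₀∈) = edgeCount E ,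
      (V , E , subgraph , linked , (λ s∈ → V⁺ (terminals-linked conn s₀∈ s∈)) , refl) ,
      ≤-trans (edgeCount-bound E treeEdges (proj₁ ∘ E⁻)) treeEdges-bound
      where
      -- `V` is the component of `s₀` under the tree edges and `E` keeps only edges inside it, which
      -- makes the subgraph connected.
      V = toSubset (star? tree? s₀)
      row? = λ x y → tree? x y ×-dec star? tree? s₀ x
      E = Vec.tabulate λ x → toSubset (row? x)
      V⁺ : ∀ {x} → Star Tree s₀ x → x ∈ V
      V⁺ = ∈-toSubset⁺ (star? tree? s₀)
      V⁻ : ∀ {x} → x ∈ V → Star Tree s₀ x
      V⁻ = ∈-toSubset⁻ (star? tree? s₀)
      E⁺ : ∀ {x y} → Tree x y → Star Tree s₀ x → Edge E x y
      E⁺ {x} {y} e s = subst (y ∈_) (sym (lookup∘tabulate _ x)) (∈-toSubset⁺ (row? x) (e , s))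
      E⁻ : ∀ {x y} → Edge E x y → Tree x y × Star Tree s₀ x
      E⁻ {x} {y} e = ∈-toSubset⁻ (row? x) (subst (y ∈_) (lookup∘tabulate _ x) e)
      subgraph : IsSubgraph G V E
      subgraph x y e with E⁻ e
      ... | xy , s = tree⇒adj xy , E⁺ (swap xy) (s ◅◅ xy ◅ ε) , V⁺ s , V⁺ (s ◅◅ xy ◅ ε)
      lift : ∀ {x y} → Star Tree s₀ x → Star Tree x y → Star (Edge E) x y
      lift s ε        = ε
      lift s (xy ◅ p) = E⁺ xy s ◅ lift (s ◅◅ xy ◅ ε) p
      linked : Linked V (Edge E)
      linked x y x∈ y∈ = lift (V⁻ x∈) (Star.reverse swap (V⁻ x∈) ◅◅ V⁻ y∈)

  -- The lower bound is applied to a subgraph that attains the minimum, and its minimality is tested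
  -- against the subgraph built from the stars.
  steinerDistance≡∑-excess : Connected G → ∀ {S d} → Nonempty S → IsSteinerDistance G S d →
                             d ≡ ∑[ i ← allFin t ] excess (G ∖ B i) S
  steinerDistance≡∑-excess conn {S} ne ((V , E , sub , linked , S⊆V , refl) , least)
    with UpperBound.upper-bound S conn ne
  ... | m , connects , m≤ = ≤-antisym (≤-trans (least m connects) m≤)
                                      (LowerBound.lower-bound S V E sub linked S⊆V)

-- Summation over the sets of size `k`.

theorem1 : ∀ {n : ℕ} (G : Graph n) (conn : Connected G) → IsBlockGraph G →
    ∀ {t : ℕ} (B : Fin t → Subset n) → AreTheBlocks G B →
    ∀ (k : ℕ) → 2 ≤ k →
    SW k G conn ≡ sum (tabulate (λ i → N′ k (G ∖ B i)))
theorem1 {n} G conn blockGraph {t} B blocks k 2≤k = begin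
  ∑[ S ← subsetsOfSize n k ] steinerDistance G conn S
    ≡⟨ ∑-cong (subsetsOfSize n k) (λ S S∈ →
         steinerDistance≡∑-excess conn (nonempty S∈) (proj₂ (steiner G conn S))) ⟩
  ∑[ S ← subsetsOfSize n k ] ∑[ i ← allFin t ] excess (G ∖ B i) S
    ≡⟨ ∑-swap (subsetsOfSize n k) (allFin t) _ ⟩
  ∑[ i ← allFin t ] ∑[ S ← subsetsOfSize n k ] excess (G ∖ B i) S
    ≡⟨ ∑-cong (allFin t) (λ i _ → N′≡∑-excess k (G ∖ B i)) ⟨
  ∑[ i ← allFin t ] N′ k (G ∖ B i)
    ≡⟨ sum-tabulate (λ i → N′ k (G ∖ B i)) ⟨
  sum (tabulate (λ i → N′ k (G ∖ B i))) ∎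
  where
  open ≡-Reasoning
  open AreTheBlocks blocks
  clique : ∀ i → IsClique G (B i)
  clique i = blockGraph (B i) (isBlock i)
  cover : ∀ {x y} → Adj G x y → ∃ λ i → x ∈ B i × y ∈ B i
  cover a with edge-in-block G a
  ... | W , isW , x∈ , y∈ with complete W isW
  ...   | i , refl = i , x∈ , y∈
  -- Maximality of the blocks yields separation, and it makes two blocks that share an edge equal;
  -- distinctness then identifies their indices.
  open BlockSystem G B clique
    (λ i → block-separates G (isBlock i) (clique i)) cover
    (λ x≢y x∈Bᵢ y∈Bᵢ x∈Bⱼ y∈Bⱼ → distinct (blocks-share-edge G (isBlock _) (isBlock _)
      (clique _) (clique _) x≢y x∈Bᵢ y∈Bᵢ x∈Bⱼ y∈Bⱼ))
  -- The connecting subgraph is grown from a vertex of `S`; the bound `2 ≤ k` provides one.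
  nonempty : ∀ {S} → S List∈.∈ subsetsOfSize n k → Nonempty S
  nonempty {S} S∈ = ∣p∣≢0⇒nonempty S λ ∣S∣≡0 →
    contradiction (subst (2 ≤_) (trans (sym ∣S∣≡k) ∣S∣≡0) 2≤k) λ ()
    where ∣S∣≡k = proj₂ (∈-filter⁻ (λ S → ∣ S ∣ ≟ k) {xs = tuples _ n} S∈)
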